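{- The reduction relation $\rightsquigarrow_{\mathrm{sua}'}$ is strongly terminating: there is no infinite sequence of reductions $s_0\rightsquigarrow_{\mathrm{sua}'}s_1\rightsquigarrow_{\mathrm{sua}'}s_2\rightsquigarrow_{\mathrm{sua}'}\cdots$ of terms.
   Context: Syntax. Syntax is taken up to renaming of variables; $\equiv$ is syntactic equality, and syntax over $\Gamma$ is silently regarded as syntax over $\Gamma,(x:A)$ (weakening). By mutual induction: a context is a finite list $(x_1:A_1),\dots,(x_m:A_m)$ with $A_i$ a type over the preceding entries; a type over $\Gamma$ is $\star$ or $s\to_A t$ with $A$ a type and $s,t$ terms over $\Gamma$; a term over $\Gamma$ is a variable of $\Gamma$ or $\mathrm{Coh}_{(\Delta;A)}[\sigma]$ with $\Delta$ a context, $A$ a type over $\Delta$ and $\sigma:\Delta\to\Gamma$; a substitution $\sigma:\Delta\to\Gamma$ is a list of terms over $\Gamma$, one for each variable of $\Delta$. $x[\![\sigma]\!]$ is the entry of $\sigma$ at the variable $x$; $\mathrm{Coh}_{(\Theta;A)}[\tau][\![\sigma]\!]=\mathrm{Coh}_{(\Theta;A)}[\tau\bullet\sigma]$, where $\tau\bullet\sigma$ applies $[\![\sigma]\!]$ to each entry of $\tau$; $\star[\![\sigma]\!]=\star$; $(s\to_At)[\![\sigma]\!]=s[\![\sigma]\!]\to_{A[\![\sigma]\!]}t[\![\sigma]\!]$. $\mathrm{id}_\Gamma$ sends each variable to itself. $\dim\star=0$, $\dim(s\to_At)=\dim A+1$; the dimension of a context is the maximal dimension of its types. Suspension: $\Sigma\Gamma$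 is $(N:\star),(S:\star)$ followed by $(x:\Sigma A)$ for $(x:A)\in\Gamma$; $\Sigma\star=N\to_\star S$, $\Sigma(s\to_At)=\Sigma s\to_{\Sigma A}\Sigma t$, $\Sigma x=x$, $\Sigma\mathrm{Coh}_{(\Delta;A)}[\sigma]=\mathrm{Coh}_{(\Sigma\Delta;\Sigma A)}[\Sigma\sigma]$, and $\Sigma\sigma$ sends $N\mapsto N$, $S\mapsto S$, $x\mapsto\Sigma(x[\![\sigma]\!])$. Ps-contexts. $(x:\star)\vdash_{ps}x:\star$; if $\Gamma\vdash_{ps}x:A$ then $\Gamma,(y:A),(f:x\to_Ay)\vdash_{ps}f:x\to_Ay$; if $\Gamma\vdash_{ps}x:s\to_At$ then $\Gamma\vdash_{ps}t:A$; if $\Gamma\vdash_{ps}x:\star$ then $\Gamma\vdash_{ps}$ ($\Gamma$ is a ps-context). For $i\in\mathbb N$, $\epsilon\in\{ -,+\}$: $\partial_i^\epsilon((x:\star))=\{x\}$, and for $\Delta=\Gamma,(y:A),(f:x\to_Ay)$, $\partial^\epsilon_i(\Delta)$ is $\partial_i^\epsilon(\Gamma)$ if $i<\dim A$; $\partial_i^-(\Gamma)$ if $i=\dim A$, $\epsilon=-$; $(\partial_i^+(\Gamma)\cup\{y\})\setminus\{x\}$ if $i=\dim A$, $\epsilon=+$; $\partial_i^\epsilon(\Gamma)\cup\{y,f\}$ if $i>\dim A$. Support. $\mathrm{FV}(x)=\{x\}$, $\mathrm{FV}(\mathrm{Coh}_{(\Delta;A)}[\sigma])=\mathrm{FV}(\sigma)$,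 $\mathrm{FV}(\star)=\emptyset$, and $\mathrm{FV}$ of arrow types and substitutions is the union over components. $\mathrm{Supp}$ of syntax over $\Gamma$ is the smallest set $U\supseteq\mathrm{FV}$ such that $x\in U$ and $(x:A)\in\Gamma$ imply $\mathrm{FV}(A)\subseteq U$. Typing and equality. Let $\mathcal O$ be the regular operation set: all triples $(\Delta,\partial_n^-(\Delta),\partial_n^+(\Delta))$ with $\Delta$ a ps-context, $n\in\mathbb N$, $n\ge\dim\Delta-1$. An equality rule set $\mathcal R$ is a set of triples $(\Gamma,s,t)$, $s,t$ terms over $\Gamma$. The theory $\mathrm{Catt}_{\mathcal R}$ is generated mutually by: $\emptyset\vdash$; $\Gamma\vdash$, $\Gamma\vdash A$ give $\Gamma,(x:A)\vdash$; $\Gamma\vdash\star$; $\Gamma\vdash A$, $\Gamma\vdash s:A$, $\Gamma\vdash t:A$ give $\Gamma\vdash s\to_At$; $\Gamma\vdash\langle\rangle:\emptyset$; $\Gamma\vdash\sigma:\Delta$, $\Gamma\vdash t:A[\![\sigma]\!]$ give $\Gamma\vdash\langle\sigma,t\rangle:\Delta,(x:A)$; $(x:A)\in\Gamma$ gives $\Gamma\vdash x:A$; $\Gamma\vdash t:A$, $\Gamma\vdash A=B$ give $\Gamma\vdash t:B$; $\Delta\vdash_{ps}$, $\Delta\vdash s\to_At$, $\Gamma\vdash\sigma:\Delta$, $(\Delta,\mathrm{Supp}(s),\mathrm{Supp}(t))\in\mathcal O$ give $\Gamma\vdash\mathrm{Coh}_{(\Delta;s\to_At)}[\sigma]:(s\to_At)[\![\sigma]\!]$;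 equality is a congruence for all constructors (for coherences: $\Delta\vdash A=B$, $\Gamma\vdash\sigma=\tau$ give $\Gamma\vdash\mathrm{Coh}_{(\Delta;A)}[\sigma]=\mathrm{Coh}_{(\Delta;B)}[\tau]$), reflexive on variables, symmetric and transitive on terms, and $\Gamma\vdash s=t$ whenever $(\Gamma,s,t)\in\mathcal R$ and $\Gamma\vdash s:A$ for some $A$. Discs. $U^0=\star$, $U^{k+1}=d_k^-\to_{U^k}d_k^+$; $D^n$ has variables $d_0^-,d_0^+,\dots,d_{n-1}^-,d_{n-1}^+,d_n$ with $d_k^\pm:U^k$, $d_n:U^n$. For a type $A$ over $\Gamma$ with $\dim A=n$ and a term $t$, $\{A,t\}:D^n\to\Gamma$ is the substitution with $d_n\mapsto t$ and $U^n[\![\{A,t\}]\!]\equiv A$. $\mathrm{id}(A,t)=\mathrm{Coh}_{(D^n;d_n\to_{U^n}d_n)}[\{A,t\}]$; terms of this form are identities. Terms $\mathrm{Coh}_{(D^n;U^n)}[\{A,t\}]$ are unary composites. Trees. A tree is a (possibly empty) finite list of trees; $\Sigma T=[T]$; $+\!\!+$ is concatenation. $\mathrm h([\,])=0$, $\mathrm h([T_0,\dots,T_n])=1+\max_k\mathrm h(T_k)$; $\mathrm{th}([T_0])=1+\mathrm{th}(T_0)$ and $\mathrm{th}(T)=0$ if $\mathrm{len}(T)\ne1$; $T$ is linear if $\mathrm{th}(T)=\mathrm h(T)$. $T^{[\,]}=T$, $T^{k::P}=(T_k)^P$. The wedge $\Gamma\vee\Delta$ of nonempty contexts is $\Gamma$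 followed by the entries of $\Delta$ other than its first, with the first variable of $\Delta$ replaced by the last $0$-dimensional variable of $\Gamma$. $\lfloor[\,]\rfloor=D^0$, $\lfloor[T_0,\dots,T_n]\rfloor=\Sigma\lfloor T_0\rfloor\vee\cdots\vee\Sigma\lfloor T_n\rfloor$. A path of $T$ is a list $q+\!\!+[n]$ with $q$ indexing a subtree $T^q$ and $0\le n\le\mathrm{len}(T^q)$; paths are identified with the variables of $\lfloor T\rfloor$: $[n]$ is the $n$-th $0$-dimensional variable (from $0$), and $k::p$ is the variable coming from the variable $p$ of $\lfloor T_k\rfloor$ in the $k$-th wedge summand. $\mathrm{inc}_k:\Sigma\lfloor T_k\rfloor\to\lfloor T\rfloor$ sends $N\mapsto[k]$, $S\mapsto[k+1]$, $p\mapsto k::p$. $\lfloor\Sigma^n[\,]\rfloor\equiv D^n$. A labelling $L:T\to\Gamma$ is a function from paths of $T$ to terms over $\Gamma$, identified with the substitution $\lfloor T\rfloor\to\Gamma$ with these entries; $L_i(p)=L(i::p)$. Standard constructions. $\partial_0(T)=[\,]$, $\partial_{n+1}([T_0,\dots,T_m])=[\partial_n(T_0),\dots,\partial_n(T_m)]$; $\delta_n^\epsilon(T):\lfloor\partial_n(T)\rfloor\to\lfloor T\rfloor$ is given on paths by $\delta_0^-([0])=[0]$, $\delta_0^+([0])=[\mathrm{len}(T)]$, $\delta_{n+1}^\epsilon(T)([k])=[k]$, $\delta_{n+1}^\epsilon(T)(k::p)=k::\delta_n^\epsilon(T_k)(p)$. $\mathcal U_T^0=\star$, $\mathcal U_T^{n+1}=\mathcal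 T^n_{\partial_n(T)}[\![\delta_n^-(T)]\!]\to_{\mathcal U^n_T}\mathcal T^n_{\partial_n(T)}[\![\delta_n^+(T)]\!]$; $\mathcal C_T^n=\mathrm{Coh}_{(\lfloor T\rfloor;\mathcal U_T^n)}[\mathrm{id}]$; $\mathcal T_{[\,]}^0$ is the path $[0]$, $\mathcal T^{n+1}_{[T_0]}=\Sigma\mathcal T^n_{T_0}$, and $\mathcal T_T^n=\mathcal C_T^n$ otherwise. Insertion. A branch $P$ of $S$ is a nonempty list indexing a linear subtree $S^P$; $\overline P$ is $P$ followed by $\mathrm h(S^P)+1$ zeros (a path of $S$); $\mathrm{bh}(P)=\mathrm{len}(P)-1$, $\mathrm{lh}(P)=\mathrm{len}(\overline P)-1$. $(S,P,T)$ is an insertion point if $\mathrm{bh}(P)\le\mathrm{th}(T)$ and $\mathrm{lh}(P)\ge\mathrm h(T)$. Let $S=[S_0,\dots,S_n]$, $m=\mathrm{len}(T)$. Inserted tree: $S\ll_{[k]}T=[S_0,\dots,S_{k-1}]+\!\!+T+\!\!+[S_{k+1},\dots,S_n]$; for $P=k::Q$ with $Q$ nonempty (so $T=[T_0]$), $S\ll_PT=[S_0,\dots,S_{k-1},S_k\ll_QT_0,S_{k+1},\dots,S_n]$. Interior $\iota:\lfloor T\rfloor\to\lfloor S\ll_PT\rfloor$: for $P=[k]$, $\iota([j])=[k+j]$, $\iota(j::p)=(k+j)::p$; for $P=k::Q$, $\iota([j])=[k+j]$, $\iota(0::p)=\Sigma(\iota_{S_k,Q,T_0}(p))[\![\mathrm{inc}_k]\!]$.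 Exterior $\kappa:\lfloor S\rfloor\to\lfloor S\ll_PT\rfloor$: for $P=[k]$, $\kappa([j])=[j]$ if $j\le k$ and $[j+m-1]$ if $j>k$; $\kappa(j::p)=j::p$ if $j<k$ and $(j+m-1)::p$ if $j>k$; $\kappa(k::p)=(0::p)[\![\{\mathcal U_T^d,\mathcal C_T^d\}]\!][\![\iota]\!]$, where $d=\mathrm h(S_k)+1$ and $0::p$ is a path of $\Sigma S_k$, i.e. a variable of $D^d$. For $P=k::Q$, $\kappa([j])=[j]$, $\kappa(j::p)=j::p$ if $j\neq k$, $\kappa(k::p)=\Sigma(\kappa_{S_k,Q,T_0}(p))[\![\mathrm{inc}_k]\!]$. Inserted labelling of $L:S\to\Gamma$, $M:T\to\Gamma$: for $P=[k]$, $(L\ll_PM)([j])$ is $L[j]$ if $j<k$, $M[j-k]$ if $k\le j\le k+m$, $L[j-m+1]$ if $j>k+m$; $(L\ll_PM)(j::p)$ is $L(j::p)$ if $j<k$, $M((j-k)::p)$ if $k\le j<k+m$, $L((j-m+1)::p)$ if $j\ge k+m$. For $P=k::Q$, $(L\ll_PM)([j])$ is $M[0],M[1]$ for $j=k,k+1$ and $L[j]$ otherwise; $(L\ll_PM)(j::p)=L(j::p)$ for $j\ne k$, and $(L\ll_PM)(k::p)=(L_k\ll_QM_0)(p)$. $(S,P,T,\Gamma,L,M)$ is an insertion redex if moreover $L(\overline P)\equiv\mathcal C_T^{\mathrm{lh}(P)}[\![M]\!]$. Rule sets. $\mathrm{dr}$: all $(\Gamma,\mathrm{Coh}_{(D^n;U^n)}[\{A,t\}],t)$,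 $n=\dim A$. $\mathrm{ecr}'$: all $(\Gamma,\mathrm{Coh}_{(\Delta;s\to_As)}[\sigma],\mathrm{id}(A[\![\sigma]\!],s[\![\sigma]\!]))$ whose first term is not an identity. $\mathrm{insert}'$: all $(\Gamma,\mathrm{Coh}_{(\lfloor S\rfloor;A)}[L],\mathrm{Coh}_{(\lfloor S\ll_PT\rfloor;A[\![\kappa]\!])}[L\ll_PM])$ for an insertion redex $(S,P,T,\Gamma,L,M)$ and a type $A$ over $\lfloor S\rfloor$ such that $\mathrm{Coh}_{(\lfloor S\rfloor;A)}[L]$ is neither an identity nor a unary composite, and $L(\overline P)\equiv\mathcal C_T^{\mathrm{lh}(P)}[\![M]\!]$ is either an identity, or a standard composite (i.e. $\mathrm{lh}(P)=\mathrm h(T)$) which is not a unary composite. $\mathrm{sua}'=\mathrm{dr}\cup\mathrm{ecr}'\cup\mathrm{insert}'$. Reduction. For a rule set $\mathcal R$, $\rightsquigarrow_{\mathcal R}$ is the relation on well-formed terms, types and substitutions (of $\mathrm{Catt}_{\mathcal R}$) generated by: $s\rightsquigarrow t$ if $(\Gamma,s,t)\in\mathcal R$; $\mathrm{Coh}_{(\Delta;A)}[\sigma]\rightsquigarrow\mathrm{Coh}_{(\Delta;B)}[\sigma]$ if $A\rightsquigarrow B$; $\mathrm{Coh}_{(\Delta;A)}[\sigma]\rightsquigarrow\mathrm{Coh}_{(\Delta;A)}[\tau]$ if $\sigma\rightsquigarrow\tau$; $s\to_At$ reduces by reducing exactly one of $s,A,t$; a substitution reduces by reducing exactly one entry. 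-}

module Defs where

open import Data.Bool using (if_then_else_)
open import Data.Fin using (Fin; zero; suc; fromℕ; inject₁; cast)
open import Data.Fin.Subset using (Subset; inside; outside; _∈_; _∪_; _-_; ⁅_⁆; ⊥)
open import Data.Nat using (ℕ; zero; suc; _+_; _*_; _∸_; _⊔_; _≤_; _<_; _<ᵇ_; _≤ᵇ_; _≡ᵇ_)
open import Data.Nat.Properties using (<-cmp)
open import Data.Product using (Σ-syntax; ∃; ∃₂; _×_)
open import Data.Sign using (Sign) renaming (- to ⊖; + to ⊕)
open import Data.Sum using (_⊎_)
open import Data.Vec using (_∷_)
open import Function using (_∘_)
open import Level using (0ℓ)
open import Relation.Binary.Definitions using (tri<; tri≈; tri>)
open import Relation.Binary.PropositionalEquality using (_≡_; refl; sym; trans; cong)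
open import Relation.Nullary using (¬_)
open import Relation.Unary using (Pred; _≐_)

-- Well-scoped de Bruijn syntax: Ty n, Tm n are types and terms over a
-- context of length n, and Sub m n is a list of m terms over a context of
-- length n, i.e. a substitution Δ → Γ with |Δ| = m and |Γ| = n.  The last
-- entry of a context is variable zero.

infixl 5 _,_
infix  6 _─⟨_⟩→_

data Ctx : ℕ → Set
data Ty (n : ℕ) : Set
data Tm (n : ℕ) : Set
data Sub : ℕ → ℕ → Set

data Ctx where
  ∅   : Ctx 0
  _,_ : ∀ {n} → Ctx n → Ty n → Ctx (suc n)

data Ty n where
  ⋆      : Ty n
  _─⟨_⟩→_ : Tm n → Ty n → Tm n → Ty n

data Tm n where
  var : Fin n → Tm n
  Coh : ∀ {m} → Ctx m → Ty m → Sub m n → Tm n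

data Sub where
  ⟨⟩    : ∀ {n} → Sub 0 n
  ⟨_,_⟩ : ∀ {m n} → Sub m n → Tm n → Sub (suc m) n

wkTy  : ∀ {n} → Ty n → Ty (suc n)
wkTm  : ∀ {n} → Tm n → Tm (suc n)
wkSub : ∀ {m n} → Sub m n → Sub m (suc n)

wkTy ⋆             = ⋆
wkTy (s ─⟨ A ⟩→ t) = wkTm s ─⟨ wkTy A ⟩→ wkTm t

wkTm (var x)     = var (suc x)
wkTm (Coh Δ A σ) = Coh Δ A (wkSub σ)

wkSub ⟨⟩        = ⟨⟩
wkSub ⟨ σ , t ⟩ = ⟨ wkSub σ , wkTm t ⟩

lookupCtx : ∀ {n} → Ctx n → Fin n → Ty n
lookupCtx (Γ , A) zero    = wkTy A
lookupCtx (Γ , A) (suc x) = wkTy (lookupCtx Γ x)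

lookupSub : ∀ {m n} → Sub m n → Fin m → Tm n
lookupSub ⟨ σ , t ⟩ zero    = t
lookupSub ⟨ σ , t ⟩ (suc x) = lookupSub σ x

idSub : ∀ {n} → Sub n n
idSub {zero}  = ⟨⟩
idSub {suc n} = ⟨ wkSub idSub , var zero ⟩

infixl 8 _[_]Ty _[_]Tm
infixl 7 _●_

_[_]Ty : ∀ {m n} → Ty m → Sub m n → Ty n
_[_]Tm : ∀ {m n} → Tm m → Sub m n → Tm n
_●_    : ∀ {l m n} → Sub l m → Sub m n → Sub l n

⋆             [ σ ]Ty = ⋆
(s ─⟨ A ⟩→ t) [ σ ]Ty = (s [ σ ]Tm) ─⟨ A [ σ ]Ty ⟩→ (t [ σ ]Tm)

var x     [ σ ]Tm = lookupSub σ x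
Coh Θ A τ [ σ ]Tm = Coh Θ A (τ ● σ)

⟨⟩        ● σ = ⟨⟩
⟨ τ , t ⟩ ● σ = ⟨ τ ● σ , t [ σ ]Tm ⟩

dimTy : ∀ {n} → Ty n → ℕ
dimTy ⋆             = 0
dimTy (s ─⟨ A ⟩→ t) = suc (dimTy A)

dimCtx : ∀ {n} → Ctx n → ℕ
dimCtx ∅       = 0
dimCtx (Γ , A) = dimCtx Γ ⊔ dimTy A

-- Suspension.  The new variables N and S come first in the context, so
-- every old variable keeps its de Bruijn index.

suspVar : ∀ {n} → Fin n → Fin (suc (suc n))
suspVar x = inject₁ (inject₁ x)

north south : ∀ {n} → Tm (suc (suc n))
north {n} = var (fromℕ (suc n))
south {n} = var (inject₁ (fromℕ n))

suspCtx : ∀ {n} → Ctx n → Ctx (suc (suc n))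
suspTy  : ∀ {n} → Ty n → Ty (suc (suc n))
suspTm  : ∀ {n} → Tm n → Tm (suc (suc n))
suspSub : ∀ {m n} → Sub m n → Sub (suc (suc m)) (suc (suc n))

suspCtx ∅       = ∅ , ⋆ , ⋆
suspCtx (Γ , A) = suspCtx Γ , suspTy A

suspTy ⋆             = north ─⟨ ⋆ ⟩→ south
suspTy (s ─⟨ A ⟩→ t) = suspTm s ─⟨ suspTy A ⟩→ suspTm t

suspTm (var x)     = var (suspVar x)
suspTm (Coh Δ A σ) = Coh (suspCtx Δ) (suspTy A) (suspSub σ)

suspSub ⟨⟩        = ⟨ ⟨ ⟨⟩ , north ⟩ , south ⟩
suspSub ⟨ σ , t ⟩ = ⟨ suspSub σ , suspTm t ⟩

data _⊢ps_∶_ : ∀ {n} → Ctx n → Fin n → Ty n → Set where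
  ps-⋆   : (∅ , ⋆) ⊢ps zero ∶ ⋆
  ps-ext : ∀ {n} {Γ : Ctx n} {x A} → Γ ⊢ps x ∶ A →
           (Γ , A , (var (suc x) ─⟨ wkTy A ⟩→ var zero))
             ⊢ps zero ∶ (var (suc (suc x)) ─⟨ wkTy (wkTy A) ⟩→ var (suc zero))
  ps-↓   : ∀ {n} {Γ : Ctx n} {x s A y} →
           Γ ⊢ps x ∶ (s ─⟨ A ⟩→ var y) → Γ ⊢ps y ∶ A

data PsCtx {n} (Γ : Ctx n) : Set where
  ps : ∀ {x} → Γ ⊢ps x ∶ ⋆ → PsCtx Γ

-- In the case ps-ext, the two leading bits stand for f and y.
boundary : ∀ {n} {Γ : Ctx n} {x A} → ℕ → Sign → Γ ⊢ps x ∶ A → Subset n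
boundary i ε ps-⋆ = ⁅ zero ⁆
boundary i ε (ps-↓ d) = boundary i ε d
boundary i ε (ps-ext {A = A} d) with <-cmp i (dimTy A)
boundary i ε (ps-ext d)         | tri< _ _ _ = outside ∷ outside ∷ boundary i ε d
boundary i ⊖ (ps-ext d)         | tri≈ _ _ _ = outside ∷ outside ∷ boundary i ⊖ d
boundary i ⊕ (ps-ext {x = x} d) | tri≈ _ _ _ = outside ∷ inside ∷ (boundary i ⊕ d - x)
boundary i ε (ps-ext d)         | tri> _ _ _ = inside ∷ inside ∷ boundary i ε d

∂ps : ∀ {n} {Γ : Ctx n} → ℕ → Sign → PsCtx Γ → Subset n
∂ps i ε (ps d) = boundary i ε d

FVTy  : ∀ {n} → Ty n → Subset n
FVTm  : ∀ {n} → Tm n → Subset n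
FVSub : ∀ {m n} → Sub m n → Subset n

FVTy ⋆             = ⊥
FVTy (s ─⟨ A ⟩→ t) = FVTm s ∪ FVTy A ∪ FVTm t

FVTm (var x)     = ⁅ x ⁆
FVTm (Coh Δ A σ) = FVSub σ

FVSub ⟨⟩        = ⊥
FVSub ⟨ σ , t ⟩ = FVSub σ ∪ FVTm t

data Closure {n} (Γ : Ctx n) (V : Subset n) : Pred (Fin n) 0ℓ where
  base : ∀ {x} → x ∈ V → Closure Γ V x
  step : ∀ {x y} → Closure Γ V x → y ∈ FVTy (lookupCtx Γ x) → Closure Γ V y

Supp : ∀ {n} → Ctx n → Tm n → Pred (Fin n) 0ℓ
Supp Γ t = Closure Γ (FVTm t)

data Regular {n} (Δ : Ctx n) (U V : Pred (Fin n) 0ℓ) : Set where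
  regular : (d : PsCtx Δ) (k : ℕ) → dimCtx Δ ∸ 1 ≤ k →
            U ≐ (_∈ ∂ps k ⊖ d) → V ≐ (_∈ ∂ps k ⊕ d) → Regular Δ U V

RuleSet : Set₁
RuleSet = ∀ {n} → Ctx n → Tm n → Tm n → Set

module Catt (ℛ : RuleSet) where

  infix 4 _⊢ty_ _⊢tm_∶_ _⊢sub_∶_ _⊢_≈ty_ _⊢_≈tm_ _⊢_≈sub_
  infix 4 _⊢_⟶ty_ _⊢_⟶tm_ _⊢_⟶sub_ _⊢_⇝_

  data _⊢ctx : ∀ {n} → Ctx n → Set
  data _⊢ty_ {n} (Γ : Ctx n) : Ty n → Set
  data _⊢tm_∶_ {n} (Γ : Ctx n) : Tm n → Ty n → Set
  data _⊢sub_∶_ {n} (Γ : Ctx n) : ∀ {m} → Sub m n → Ctx m → Set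
  data _⊢_≈ty_ {n} (Γ : Ctx n) : Ty n → Ty n → Set
  data _⊢_≈tm_ {n} (Γ : Ctx n) : Tm n → Tm n → Set
  data _⊢_≈sub_ {n} (Γ : Ctx n) : ∀ {m} → Sub m n → Sub m n → Set

  data _⊢ctx where
    ctx-∅ : ∅ ⊢ctx
    ctx-, : ∀ {n} {Γ : Ctx n} {A} → Γ ⊢ctx → Γ ⊢ty A → (Γ , A) ⊢ctx

  data _⊢ty_ {n} Γ where
    ty-⋆ : Γ ⊢ty ⋆
    ty-→ : ∀ {s A t} → Γ ⊢ty A → Γ ⊢tm s ∶ A → Γ ⊢tm t ∶ A →
           Γ ⊢ty (s ─⟨ A ⟩→ t)

  data _⊢sub_∶_ {n} Γ where
    sub-⟨⟩ : Γ ⊢sub ⟨⟩ ∶ ∅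
    sub-,  : ∀ {m} {Δ : Ctx m} {σ t A} → Γ ⊢sub σ ∶ Δ → Γ ⊢tm t ∶ A [ σ ]Ty →
             Γ ⊢sub ⟨ σ , t ⟩ ∶ (Δ , A)

  data _⊢tm_∶_ {n} Γ where
    tm-var  : ∀ x → Γ ⊢tm var x ∶ lookupCtx Γ x
    tm-conv : ∀ {t A B} → Γ ⊢tm t ∶ A → Γ ⊢ A ≈ty B → Γ ⊢tm t ∶ B
    tm-coh  : ∀ {m} {Δ : Ctx m} {s A t σ} →
              PsCtx Δ → Δ ⊢ty (s ─⟨ A ⟩→ t) → Γ ⊢sub σ ∶ Δ →
              Regular Δ (Supp Δ s) (Supp Δ t) →
              Γ ⊢tm Coh Δ (s ─⟨ A ⟩→ t) σ ∶ (s ─⟨ A ⟩→ t) [ σ ]Ty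

  data _⊢_≈ty_ {n} Γ where
    ≈-⋆ : Γ ⊢ ⋆ ≈ty ⋆
    ≈-→ : ∀ {s s′ A A′ t t′} → Γ ⊢ s ≈tm s′ → Γ ⊢ A ≈ty A′ → Γ ⊢ t ≈tm t′ →
          Γ ⊢ (s ─⟨ A ⟩→ t) ≈ty (s′ ─⟨ A′ ⟩→ t′)

  data _⊢_≈tm_ {n} Γ where
    ≈-var   : ∀ x → Γ ⊢ var x ≈tm var x
    ≈-coh   : ∀ {m} {Δ : Ctx m} {A B σ τ} → Δ ⊢ A ≈ty B → Γ ⊢ σ ≈sub τ →
              Γ ⊢ Coh Δ A σ ≈tm Coh Δ B τ
    ≈-sym   : ∀ {s t} → Γ ⊢ s ≈tm t → Γ ⊢ t ≈tm s
    ≈-trans : ∀ {s t u} → Γ ⊢ s ≈tm t → Γ ⊢ t ≈tm u → Γ ⊢ s ≈tm u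
    ≈-rule  : ∀ {s t A} → ℛ Γ s t → Γ ⊢tm s ∶ A → Γ ⊢ s ≈tm t

  data _⊢_≈sub_ {n} Γ where
    ≈-⟨⟩ : Γ ⊢ ⟨⟩ ≈sub ⟨⟩
    ≈-,  : ∀ {m} {σ τ : Sub m n} {s t} → Γ ⊢ σ ≈sub τ → Γ ⊢ s ≈tm t →
           Γ ⊢ ⟨ σ , s ⟩ ≈sub ⟨ τ , t ⟩

  data _⊢_⟶ty_ {n} (Γ : Ctx n) : Ty n → Ty n → Set
  data _⊢_⟶tm_ {n} (Γ : Ctx n) : Tm n → Tm n → Set
  data _⊢_⟶sub_ {n} (Γ : Ctx n) : ∀ {m} → Sub m n → Sub m n → Set

  data _⊢_⟶ty_ {n} Γ where
    src  : ∀ {s s′ A t} → Γ ⊢ s ⟶tm s′ → Γ ⊢ (s ─⟨ A ⟩→ t) ⟶ty (s′ ─⟨ A ⟩→ t)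
    type : ∀ {s A A′ t} → Γ ⊢ A ⟶ty A′ → Γ ⊢ (s ─⟨ A ⟩→ t) ⟶ty (s ─⟨ A′ ⟩→ t)
    tgt  : ∀ {s A t t′} → Γ ⊢ t ⟶tm t′ → Γ ⊢ (s ─⟨ A ⟩→ t) ⟶ty (s ─⟨ A ⟩→ t′)

  data _⊢_⟶tm_ {n} Γ where
    rule : ∀ {s t} → ℛ Γ s t → Γ ⊢ s ⟶tm t
    cell : ∀ {m} {Δ : Ctx m} {A B σ} → Δ ⊢ A ⟶ty B → Γ ⊢ Coh Δ A σ ⟶tm Coh Δ B σ
    args : ∀ {m} {Δ : Ctx m} {A σ τ} → Γ ⊢ σ ⟶sub τ → Γ ⊢ Coh Δ A σ ⟶tm Coh Δ A τ

  data _⊢_⟶sub_ {n} Γ where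
    init : ∀ {m} {σ τ : Sub m n} {t} → Γ ⊢ σ ⟶sub τ → Γ ⊢ ⟨ σ , t ⟩ ⟶sub ⟨ τ , t ⟩
    last : ∀ {m} {σ : Sub m n} {s t} → Γ ⊢ s ⟶tm t → Γ ⊢ ⟨ σ , s ⟩ ⟶sub ⟨ σ , t ⟩

  WellFormed : ∀ {n} → Ctx n → Tm n → Set
  WellFormed Γ t = ∃ λ A → Γ ⊢tm t ∶ A

  -- All components of a well-formed term are well formed, so restricting the
  -- two ends to well-formed terms restricts every nested step as well.
  _⊢_⇝_ : ∀ {n} → Ctx n → Tm n → Tm n → Set
  Γ ⊢ s ⇝ t = WellFormed Γ s × WellFormed Γ t × Γ ⊢ s ⟶tm t

StronglyTerminating : RuleSet → Set
StronglyTerminating ℛ = ∀ {n} (Γ : Ctx n) →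
  ¬ (Σ[ s ∈ (ℕ → Tm n) ] (∀ i → Γ ⊢ s i ⇝ s (suc i)))
  where open Catt ℛ

-- U k lives over the first 2k variables d₀⁻, d₀⁺, …, dₖ₋₁⁻, dₖ₋₁⁺.
U : ∀ k → Ty (k * 2)
U zero    = ⋆
U (suc k) = var (suc zero) ─⟨ wkTy (wkTy (U k)) ⟩→ var zero

Sphere : ∀ n → Ctx (n * 2)
Sphere zero    = ∅
Sphere (suc n) = Sphere n , U n , wkTy (U n)

Disc : ∀ n → Ctx (suc (n * 2))
Disc n = Sphere n , U n

sphereSub : ∀ {n} (A : Ty n) → Sub (dimTy A * 2) n
sphereSub ⋆             = ⟨⟩
sphereSub (s ─⟨ A ⟩→ t) = ⟨ ⟨ sphereSub A , s ⟩ , t ⟩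

discSub : ∀ {n} (A : Ty n) → Tm n → Sub (suc (dimTy A * 2)) n
discSub A t = ⟨ sphereSub A , t ⟩

identity : ∀ {n} → Ty n → Tm n → Tm n
identity A t =
  Coh (Disc (dimTy A)) (var zero ─⟨ wkTy (U (dimTy A)) ⟩→ var zero) (discSub A t)

unary : ∀ {n} → Ty n → Tm n → Tm n
unary A t = Coh (Disc (dimTy A)) (wkTy (U (dimTy A))) (discSub A t)

IsIdentity IsUnary : ∀ {n} → Tm n → Set
IsIdentity u = ∃₂ λ A t → u ≡ identity A t
IsUnary    u = ∃₂ λ A t → u ≡ unary A t

-- Finite lists of trees, with the list structure unfolded.
infixr 5 _∷_ _++_

data Tree : Set where
  []  : Tree
  _∷_ : Tree → Tree → Tree

_++_ : Tree → Tree → Tree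
[]       ++ S = S
(T ∷ Ts) ++ S = T ∷ (Ts ++ S)

take drop : ℕ → Tree → Tree
take (suc k) (T ∷ Ts) = T ∷ take k Ts
take _       _        = []
drop zero    S        = S
drop (suc k) (T ∷ Ts) = drop k Ts
drop (suc k) []       = []

len height trunk : Tree → ℕ
len []       = 0
len (T ∷ Ts) = suc (len Ts)
height []       = 0
height (T ∷ Ts) = suc (height T) ⊔ height Ts
trunk (T ∷ []) = suc (trunk T)
trunk _        = 0

Linear : Tree → Set
Linear T = trunk T ≡ height T

infixl 9 _!_
_!_ : Tree → ℕ → Tree
[]       ! k     = []
(T ∷ Ts) ! zero  = T
(T ∷ Ts) ! suc k = Ts ! k

linear : ℕ → Tree
linear zero    = []
linear (suc n) = linear n ∷ []

-- Nonempty lists of naturals, serving both as paths and as branches.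
-- Functions on them are total; their values at lists that are not paths
-- (or branches) of the tree in question are never used.
data Path : Set where
  [_] : ℕ → Path
  _∷_ : ℕ → Path → Path

_⧺_ : Path → Path → Path
[ k ]   ⧺ q = k ∷ q
(k ∷ p) ⧺ q = k ∷ (p ⧺ q)

length : Path → ℕ
length [ k ]   = 1
length (k ∷ p) = suc (length p)

-- zeros n has length n + 1.
zeros : ℕ → Path
zeros zero    = [ 0 ]
zeros (suc n) = 0 ∷ zeros n

subtree : Tree → Path → Tree
subtree T [ k ]   = T ! k
subtree T (k ∷ P) = subtree (T ! k) P

Indexes : Tree → Path → Set
Indexes T [ k ]   = k < len T
Indexes T (k ∷ P) = k < len T × Indexes (T ! k) P

-- The last 0-dimensional variable.  The first variable of a ps-context has
-- type ⋆, so its type need not be inspected.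
last₀ : ∀ {n} → Ctx (suc n) → Fin (suc n)
last₀ {zero}  (∅ , A)             = zero
last₀ {suc n} (Γ , ⋆)             = zero
last₀ {suc n} (Γ , s ─⟨ A ⟩→ t) = suc (last₀ Γ)

inlVar : ∀ {n} m → Fin (suc n) → Fin (suc (m + n))
inlVar zero    x = x
inlVar (suc m) x = suc (inlVar m x)

inrVar : ∀ {m n} → Ctx (suc n) → Fin (suc m) → Fin (suc (m + n))
inrVar {zero}  Γ _       = last₀ Γ
inrVar {suc m} Γ zero    = zero
inrVar {suc m} Γ (suc x) = suc (inrVar Γ x)

inr : ∀ {n} m → Ctx (suc n) → Sub (suc m) (suc (m + n))
inr zero    Γ = ⟨ ⟨⟩ , var (last₀ Γ) ⟩
inr (suc m) Γ = ⟨ wkSub (inr m Γ) , var zero ⟩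

_∨_ : ∀ {m n} → Ctx (suc n) → Ctx (suc m) → Ctx (suc (m + n))
_∨_ {zero}  Γ (∅ , A) = Γ
_∨_ {suc m} Γ (Δ , A) = (Γ ∨ Δ) , A [ inr m Γ ]Ty

-- One less than the number of variables of ⌊ T ⌋.
size : Tree → ℕ
size []       = 0
size (T ∷ Ts) = size Ts + suc (suc (size T))

-- D⁰ is a right unit for the wedge, so it may end the iterated wedge.
⌊_⌋ : (T : Tree) → Ctx (suc (size T))
⌊ [] ⌋     = Disc 0
⌊ T ∷ Ts ⌋ = suspCtx ⌊ T ⌋ ∨ ⌊ Ts ⌋

pathVar : ∀ T → Path → Fin (suc (size T))
pathVar T        [ zero ]    = fromℕ (size T)
pathVar (T ∷ Ts) [ suc j ]   = inrVar (suspCtx ⌊ T ⌋) (pathVar Ts [ j ])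
pathVar (T ∷ Ts) (zero ∷ p)  = inlVar (size Ts) (suspVar (pathVar T p))
pathVar (T ∷ Ts) (suc k ∷ p) = inrVar (suspCtx ⌊ T ⌋) (pathVar Ts (k ∷ p))
pathVar []       _           = zero

pathTm : ∀ T → Path → Tm (suc (size T))
pathTm T p = var (pathVar T p)

-- A labelling T → Γ is given by its substitution ⌊ T ⌋ → Γ; `label` reads off
-- the term at a path, and `toSub` forms the substitution with given entries.

Labelling : Tree → ℕ → Set
Labelling T n = Sub (suc (size T)) n

label : ∀ {n} T → Labelling T n → Path → Tm n
label T L p = lookupSub L (pathVar T p)

-- The substitution out of a suspension with N ↦ s and S ↦ t.
unsusp : ∀ {m n} → Tm n → Tm n → Sub m n → Sub (suc (suc m)) n
unsusp s t ⟨⟩        = ⟨ ⟨ ⟨⟩ , s ⟩ , t ⟩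
unsusp s t ⟨ σ , u ⟩ = ⟨ unsusp s t σ , u ⟩

-- The substitution from a wedge; the entry of the second component at its
-- first variable is dropped.
copair : ∀ {l m n} → Sub (suc n) l → Sub (suc m) l → Sub (suc (m + n)) l
copair {m = zero}  σ ⟨ ⟨⟩ , t ⟩ = σ
copair {m = suc m} σ ⟨ τ , t ⟩  = ⟨ copair σ τ , t ⟩

shift : Path → Path
shift [ j ]   = [ suc j ]
shift (k ∷ p) = suc k ∷ p

toSub : ∀ {n} T → (Path → Tm n) → Labelling T n
toSub []       f = ⟨ ⟨⟩ , f [ 0 ] ⟩
toSub (T ∷ Ts) f =
  copair (unsusp (f [ 0 ]) (f [ 1 ]) (toSub T (f ∘ (0 ∷_)))) (toSub Ts (f ∘ shift))

-- The inclusion Σ⌊ Tₖ ⌋ → ⌊ T ⌋.  The child Tₖ is an argument, as it is often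
-- given by an expression that is only propositionally equal to T ! k.
inc : ∀ T k Tₖ → Sub (suc (suc (suc (size Tₖ)))) (suc (size T))
inc T k Tₖ =
  unsusp (pathTm T [ k ]) (pathTm T [ k + 1 ]) (toSub Tₖ (λ p → pathTm T (k ∷ p)))

∂ : ℕ → Tree → Tree
∂ zero    T        = []
∂ (suc n) []       = []
∂ (suc n) (T ∷ Ts) = ∂ n T ∷ ∂ (suc n) Ts

δPath : ℕ → Sign → Tree → Path → Path
δPath zero    ⊖ T _       = [ 0 ]
δPath zero    ⊕ T _       = [ len T ]
δPath (suc n) ε T [ k ]   = [ k ]
δPath (suc n) ε T (k ∷ p) = k ∷ δPath n ε (T ! k) p

δ : ∀ n → Sign → ∀ T → Labelling (∂ n T) (suc (size T))
δ n ε T = toSub (∂ n T) (pathTm T ∘ δPath n ε T)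

𝒰 : ℕ → ∀ T → Ty (suc (size T))
𝒯 : ℕ → ∀ T → Tm (suc (size T))
𝒞 : ℕ → ∀ T → Tm (suc (size T))

𝒰 zero    T = ⋆
𝒰 (suc n) T = (𝒯 n (∂ n T) [ δ n ⊖ T ]Tm) ─⟨ 𝒰 n T ⟩→ (𝒯 n (∂ n T) [ δ n ⊕ T ]Tm)

𝒯 zero    []       = pathTm [] [ 0 ]
𝒯 (suc n) (T ∷ []) = suspTm (𝒯 n T)
𝒯 n       T        = 𝒞 n T

𝒞 n T = Coh ⌊ T ⌋ (𝒰 n T) idSub

Branch : Tree → Path → Set
Branch S P = Indexes S P × Linear (subtree S P)

lastPath : Tree → Path → Path
lastPath S P = P ⧺ zeros (height (subtree S P))

branchHeight : Path → ℕ
branchHeight P = length P ∸ 1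

leafHeight : Tree → Path → ℕ
leafHeight S P = length (lastPath S P) ∸ 1

InsertionPoint : Tree → Path → Tree → Set
InsertionPoint S P T =
  Branch S P × branchHeight P ≤ trunk T × height T ≤ leafHeight S P

-- At an insertion point with P = k ∷ Q, the tree T has exactly one child, so
-- below T ! 0 is that child, and a path j ∷ p of T has j = 0.

infix 6 _≪[_]_
_≪[_]_ : Tree → Path → Tree → Tree
S ≪[ [ k ] ] T = take k S ++ T ++ drop (suc k) S
S ≪[ k ∷ Q ] T = take k S ++ (((S ! k) ≪[ Q ] (T ! 0)) ∷ drop (suc k) S)

ιTm : ∀ S P T → Path → Tm (suc (size (S ≪[ P ] T)))
ιTm S [ k ]   T [ j ]   = pathTm (S ≪[ [ k ] ] T) [ k + j ]
ιTm S [ k ]   T (j ∷ p) = pathTm (S ≪[ [ k ] ] T) (k + j ∷ p)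
ιTm S (k ∷ Q) T [ j ]   = pathTm (S ≪[ k ∷ Q ] T) [ k + j ]
ιTm S (k ∷ Q) T (_ ∷ p) =
  suspTm (ιTm (S ! k) Q (T ! 0) p)
    [ inc (S ≪[ k ∷ Q ] T) k ((S ! k) ≪[ Q ] (T ! 0)) ]Tm

ι : ∀ S P T → Labelling T (suc (size (S ≪[ P ] T)))
ι S P T = toSub T (ιTm S P T)

size-linear : ∀ d → size (linear d) ≡ d * 2
size-linear zero    = refl
size-linear (suc d) = cong (2 +_) (size-linear d)

dim-𝒰 : ∀ d T → dimTy (𝒰 d T) ≡ d
dim-𝒰 zero    T = refl
dim-𝒰 (suc d) T = cong suc (dim-𝒰 d T)

-- The entry of {𝒰ᵈ , 𝒞ᵈ} at a path of Σᵈ [], i.e. at a variable of Dᵈ.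
standardEntry : ∀ d T → Path → Tm (suc (size T))
standardEntry d T p =
  lookupSub (discSub (𝒰 d T) (𝒞 d T))
    (cast (cong suc (trans (size-linear d) (cong (_* 2) (sym (dim-𝒰 d T)))))
      (pathVar (linear d) p))

κTm : ∀ S P T → Path → Tm (suc (size (S ≪[ P ] T)))
κTm S [ k ] T [ j ] =
  pathTm (S ≪[ [ k ] ] T) (if j ≤ᵇ k then [ j ] else [ j + len T ∸ 1 ])
κTm S [ k ] T (j ∷ p) =
  if j <ᵇ k then pathTm (S ≪[ [ k ] ] T) (j ∷ p)
  else if j ≡ᵇ k then standardEntry (height (S ! k) + 1) T (0 ∷ p) [ ι S [ k ] T ]Tm
  else pathTm (S ≪[ [ k ] ] T) (j + len T ∸ 1 ∷ p)
κTm S (k ∷ Q) T [ j ] = pathTm (S ≪[ k ∷ Q ] T) [ j ]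
κTm S (k ∷ Q) T (j ∷ p) =
  if j ≡ᵇ k
  then suspTm (κTm (S ! k) Q (T ! 0) p)
         [ inc (S ≪[ k ∷ Q ] T) k ((S ! k) ≪[ Q ] (T ! 0)) ]Tm
  else pathTm (S ≪[ k ∷ Q ] T) (j ∷ p)

κ : ∀ S P T → Labelling S (suc (size (S ≪[ P ] T)))
κ S P T = toSub S (κTm S P T)

insertTm : ∀ {n} → Path → Tree → (Path → Tm n) → (Path → Tm n) → Path → Tm n
insertTm [ k ] T L M [ j ] =
  if j <ᵇ k then L [ j ]
  else if j ≤ᵇ k + len T then M [ j ∸ k ]
  else L [ j ∸ len T + 1 ]
insertTm [ k ] T L M (j ∷ p) =
  if j <ᵇ k then L (j ∷ p)
  else if j <ᵇ k + len T then M (j ∸ k ∷ p)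
  else L (j ∸ len T + 1 ∷ p)
insertTm (k ∷ Q) T L M [ j ] =
  if j ≡ᵇ k then M [ 0 ]
  else if j ≡ᵇ k + 1 then M [ 1 ]
  else L [ j ]
insertTm (k ∷ Q) T L M (j ∷ p) =
  if j ≡ᵇ k then insertTm Q (T ! 0) (L ∘ (k ∷_)) (M ∘ (0 ∷_)) p
  else L (j ∷ p)

insertLabelling : ∀ {n} S P T → Labelling S n → Labelling T n → Labelling (S ≪[ P ] T) n
insertLabelling S P T L M =
  toSub (S ≪[ P ] T) (insertTm P T (label S L) (label T M))

InsertionRedex : ∀ {n} S P T → Labelling S n → Labelling T n → Set
InsertionRedex S P T L M =
  InsertionPoint S P T ×
  label S L (lastPath S P) ≡ 𝒞 (leafHeight S P) T [ M ]Tm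

data dr {n} (Γ : Ctx n) : Tm n → Tm n → Set where
  disc-removal : ∀ A t → dr Γ (unary A t) t

data ecr′ {n} (Γ : Ctx n) : Tm n → Tm n → Set where
  endo-coherence-removal :
    ∀ {m} (Δ : Ctx m) s A (σ : Sub m n) →
    ¬ IsIdentity (Coh Δ (s ─⟨ A ⟩→ s) σ) →
    ecr′ Γ (Coh Δ (s ─⟨ A ⟩→ s) σ) (identity (A [ σ ]Ty) (s [ σ ]Tm))

data insert′ {n} (Γ : Ctx n) : Tm n → Tm n → Set where
  insertion :
    ∀ S P T (L : Labelling S n) (M : Labelling T n) (A : Ty (suc (size S))) →
    InsertionRedex S P T L M →
    ¬ IsIdentity (Coh ⌊ S ⌋ A L) → ¬ IsUnary (Coh ⌊ S ⌋ A L) →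
    IsIdentity (label S L (lastPath S P)) ⊎
      (leafHeight S P ≡ height T × ¬ IsUnary (label S L (lastPath S P))) →
    insert′ Γ (Coh ⌊ S ⌋ A L)
      (Coh ⌊ S ≪[ P ] T ⌋ (A [ κ S P T ]Ty) (insertLabelling S P T L M))

sua′ : RuleSet
sua′ Γ s t = dr Γ s t ⊎ ecr′ Γ s t ⊎ insert′ Γ s t

{-# OPTIONS --safe #-}
module Submission where

-- Count the coherences of a term that lie outside all cells by the dimension d
-- of their cell, identities once and other coherences twice, and read the
-- counts as an ordinal Σ ω^d · (count at d).  Regularity bounds the dimension of
-- every such coherence in a well-formed term by that of the term, so an
-- endo-coherence removal trades a weight 2 for a weight 1 at the top dimension,
-- whatever it duplicates below.  Disc removal passes to an argument, and insertion
-- at most replaces an argument by its own arguments, so there the counts decrease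
-- pointwise.  A step inside a cell does not increase any
-- count, and cells are made of terms of smaller dimension; hence termination
-- follows by induction on the dimension.

open import Data.Bool using (true; false; if_then_else_) renaming (T to IsTrue)
open import Data.Fin using (Fin; zero; suc; fromℕ; inject₁)
import Data.Fin.Properties as Fin
open import Data.Fin.Subset using (_∈_; _∪_; ⁅_⁆)
open import Data.Fin.Subset.Properties using (x∈p∪q⁻; x∈⁅y⁆⇒x≡y; ∉⊥)
open import Data.Nat
  using (ℕ; zero; suc; _+_; _*_; _∸_; _⊓_; _≤_; _<_; z≤n; s≤s; s≤s⁻¹; s<s⁻¹; _<ᵇ_; _≟_)
open import Data.Nat.Induction using (<-wellFounded)
open import Data.Nat.Properties hiding (_≟_)
open import Data.Nat.Tactic.RingSolver using (solve-∀)
open import Data.Product using (Σ-syntax; ∃-syntax; _×_; _,_; proj₁; proj₂)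
open import Data.Sign using () renaming (- to ⊖)
open import Data.Sum using (_⊎_; inj₁; inj₂; [_,_]′)
import Data.Sum as Sum
open import Data.Vec using (here; there)
open import Function using (_∘_; flip)
open import Induction.WellFounded using (Acc; acc)
open import Relation.Binary.Definitions using (DecidableEquality; tri<; tri≈; tri>)
open import Relation.Binary.PropositionalEquality
open import Relation.Nullary using (¬_; Dec; yes; no; does; contradiction)
open import Relation.Nullary.Decidable using (map′; _×-dec_; dec-true; dec-false)

open import Defs renaming (_,_ to infixl 5 _▹_)

-- Sums over the entries of a labelling

sumSub : ∀ {m n} → (Tm n → ℕ) → Sub m n → ℕ
sumSub φ ⟨⟩        = 0
sumSub φ ⟨ σ , t ⟩ = sumSub φ σ + φ t

-- Each path counts exactly once: `[ 0 ]`, the paths through the first child, and the remaining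
-- ones, reindexed by `shift`. Insertion is recursive in the tree, so counting is easier here than
-- on de Bruijn indices.
sumTree : Tree → (Path → ℕ) → ℕ
sumTree []       g = g [ 0 ]
sumTree (T ∷ Ts) g = g [ 0 ] + sumTree T (g ∘ (0 ∷_)) + sumTree Ts (g ∘ shift)

sumTree-cong : ∀ T {f g : Path → ℕ} → (∀ p → f p ≡ g p) → sumTree T f ≡ sumTree T g
sumTree-cong []       f≗g = f≗g [ 0 ]
sumTree-cong (T ∷ Ts) f≗g =
  cong₂ _+_ (cong₂ _+_ (f≗g [ 0 ]) (sumTree-cong T (f≗g ∘ (0 ∷_))))
    (sumTree-cong Ts (f≗g ∘ shift))

-- An equality of differences, with the root values added crosswise because subtraction truncates.
-- It serves where insertion overrides the label of a gluing vertex.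
sumTree-changeRoot : ∀ T (f g : Path → ℕ) →
  (∀ j → f [ suc j ] ≡ g [ suc j ]) → (∀ k p → f (k ∷ p) ≡ g (k ∷ p)) →
  sumTree T f + g [ 0 ] ≡ sumTree T g + f [ 0 ]
sumTree-changeRoot []       f g f≗g₀ f≗g = +-comm (f [ 0 ]) (g [ 0 ])
sumTree-changeRoot (T ∷ Ts) f g f≗g₀ f≗g
  rewrite sumTree-cong T (f≗g 0)
        | sumTree-cong Ts {f ∘ shift} {g ∘ shift}
            (λ { [ j ] → f≗g₀ j ; (k ∷ p) → f≗g (suc k) p }) =
  swapEnds (f [ 0 ]) (sumTree T (g ∘ (0 ∷_))) (sumTree Ts (g ∘ shift)) (g [ 0 ])
  where
  swapEnds : ∀ a b c d → a + b + c + d ≡ d + b + c + a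
  swapEnds = solve-∀

sumTree-leaf : ∀ T (g : Path → ℕ) → Linear T → g (zeros (height T)) ≤ sumTree T g
sumTree-leaf []           g _   = ≤-refl
sumTree-leaf (T ∷ [])     g lin =
  ≤-trans (sumTree-leaf T (g ∘ (0 ∷_)) (suc-injective lin))
    (≤-trans (m≤n+m _ (g [ 0 ])) (m≤m+n _ _))
-- Two or more children give trunk 0 but positive height, so the tree is not linear.
sumTree-leaf (T ∷ U ∷ Us) g lin =
  contradiction (≤-trans (m≤m⊔n (suc (height T)) (height (U ∷ Us))) (≤-reflexive (sym lin))) λ ()

module _ {n} (φ : Tm n → ℕ) where

  -- `copair` drops the first entry of `τ`, so its value is added back on the left.
  sum-copair : ∀ {k m} (σ : Sub (suc k) n) (τ : Sub (suc m) n) →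
    sumSub φ (copair σ τ) + φ (lookupSub τ (fromℕ m)) ≡ sumSub φ σ + sumSub φ τ
  sum-copair {m = zero}  σ ⟨ ⟨⟩ , t ⟩ = refl
  sum-copair {m = suc m} σ ⟨ τ , t ⟩  = begin
    sumSub φ (copair σ τ) + φ t + x   ≡⟨ +-comm-right (sumSub φ (copair σ τ)) (φ t) x ⟩
    sumSub φ (copair σ τ) + x + φ t   ≡⟨ cong (_+ φ t) (sum-copair σ τ) ⟩
    sumSub φ σ + sumSub φ τ + φ t     ≡⟨ +-assoc (sumSub φ σ) (sumSub φ τ) (φ t) ⟩
    sumSub φ σ + (sumSub φ τ + φ t)   ∎
    where
    open ≡-Reasoning
    x = φ (lookupSub τ (fromℕ m))
    +-comm-right : ∀ a b c → a + b + c ≡ a + c + b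
    +-comm-right = solve-∀

  sum-unsusp : ∀ {m} s t (σ : Sub m n) →
    sumSub φ (unsusp s t σ) ≡ φ s + φ t + sumSub φ σ
  sum-unsusp s t ⟨⟩        = sym (+-identityʳ _)
  sum-unsusp s t ⟨ σ , u ⟩ =
    trans (cong (_+ φ u) (sum-unsusp s t σ)) (+-assoc (φ s + φ t) (sumSub φ σ) (φ u))

lookup-copair-first : ∀ {k m n} (σ : Sub (suc k) n) (τ : Sub (suc m) n) →
  lookupSub (copair σ τ) (fromℕ (m + k)) ≡ lookupSub σ (fromℕ k)
lookup-copair-first {m = zero}  σ ⟨ ⟨⟩ , t ⟩ = refl
lookup-copair-first {m = suc m} σ ⟨ τ , t ⟩  = lookup-copair-first σ τ

lookup-unsusp-first : ∀ {m n} s t (σ : Sub m n) →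
  lookupSub (unsusp s t σ) (fromℕ (suc m)) ≡ s
lookup-unsusp-first s t ⟨⟩        = refl
lookup-unsusp-first s t ⟨ σ , u ⟩ = lookup-unsusp-first s t σ

lookup-toSub-first : ∀ {n} T (f : Path → Tm n) →
  lookupSub (toSub T f) (fromℕ (size T)) ≡ f [ 0 ]
lookup-toSub-first []       f = refl
lookup-toSub-first (T ∷ Ts) f =
  trans (lookup-copair-first _ (toSub Ts (f ∘ shift)))
    (lookup-unsusp-first (f [ 0 ]) (f [ 1 ]) (toSub T (f ∘ (0 ∷_))))

sum-toSub : ∀ {n} (φ : Tm n → ℕ) T f → sumSub φ (toSub T f) ≡ sumTree T (φ ∘ f)
sum-toSub φ []       f = refl
-- `f [ 1 ]` is both the south pole of the first suspension and the root of the rest; `copair` keeps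
-- one copy, so the other is added and cancelled.
sum-toSub φ (T ∷ Ts) f = +-cancelʳ-≡ (φ (f [ 1 ])) _ _ (begin
  sumSub φ (copair σ τ) + φ (f [ 1 ])
    ≡⟨ cong (λ t → sumSub φ (copair σ τ) + φ t) (lookup-toSub-first Ts (f ∘ shift)) ⟨
  sumSub φ (copair σ τ) + φ (lookupSub τ (fromℕ (size Ts)))
    ≡⟨ sum-copair φ σ τ ⟩
  sumSub φ σ + sumSub φ τ
    ≡⟨ cong₂ _+_ (sum-unsusp φ (f [ 0 ]) (f [ 1 ]) (toSub T (f ∘ (0 ∷_))))
         (sum-toSub φ Ts (f ∘ shift)) ⟩
  φ (f [ 0 ]) + φ (f [ 1 ]) + sumSub φ (toSub T (f ∘ (0 ∷_))) + c
    ≡⟨ cong (λ b → φ (f [ 0 ]) + φ (f [ 1 ]) + b + c) (sum-toSub φ T (f ∘ (0 ∷_))) ⟩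
  φ (f [ 0 ]) + φ (f [ 1 ]) + b + c
    ≡⟨ moveRight (φ (f [ 0 ])) (φ (f [ 1 ])) b c ⟩
  φ (f [ 0 ]) + b + c + φ (f [ 1 ]) ∎)
  where
  open ≡-Reasoning
  σ = unsusp (f [ 0 ]) (f [ 1 ]) (toSub T (f ∘ (0 ∷_)))
  τ = toSub Ts (f ∘ shift)
  b = sumTree T (φ ∘ f ∘ (0 ∷_))
  c = sumTree Ts (φ ∘ f ∘ shift)
  moveRight : ∀ a x b c → a + x + b + c ≡ a + b + c + x
  moveRight = solve-∀

-- The two restrictions of a substitution out of a wedge, opposite to `copair`; the right one
-- recovers its first entry from the wedge point.
wedgeLeft : ∀ {k n} m → Sub (suc (m + k)) n → Sub (suc k) n
wedgeLeft zero    L         = L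
wedgeLeft (suc m) ⟨ L , t ⟩ = wedgeLeft m L

wedgeRight : ∀ {k n} m → Ctx (suc k) → Sub (suc (m + k)) n → Sub (suc m) n
wedgeRight zero    Γ L         = ⟨ ⟨⟩ , lookupSub L (last₀ Γ) ⟩
wedgeRight (suc m) Γ ⟨ L , t ⟩ = ⟨ wedgeRight m Γ L , t ⟩

unwrap : ∀ {m n} → Sub (suc (suc m)) n → Sub m n
unwrap {zero}  _         = ⟨⟩
unwrap {suc m} ⟨ σ , t ⟩ = ⟨ unwrap σ , t ⟩

lookup-wedgeLeft : ∀ {k n} m (L : Sub (suc (m + k)) n) x →
  lookupSub L (inlVar m x) ≡ lookupSub (wedgeLeft m L) x
lookup-wedgeLeft zero    L         x = refl
lookup-wedgeLeft (suc m) ⟨ L , t ⟩ x = lookup-wedgeLeft m L x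

lookup-wedgeLeft-first : ∀ {k n} m (L : Sub (suc (m + k)) n) →
  lookupSub L (fromℕ (m + k)) ≡ lookupSub (wedgeLeft m L) (fromℕ k)
lookup-wedgeLeft-first zero    L         = refl
lookup-wedgeLeft-first (suc m) ⟨ L , t ⟩ = lookup-wedgeLeft-first m L

lookup-wedgeRight : ∀ {k n} m (Γ : Ctx (suc k)) (L : Sub (suc (m + k)) n) x →
  lookupSub L (inrVar Γ x) ≡ lookupSub (wedgeRight m Γ L) x
lookup-wedgeRight zero    Γ L         zero    = refl
lookup-wedgeRight (suc m) Γ ⟨ L , t ⟩ zero    = refl
lookup-wedgeRight (suc m) Γ ⟨ L , t ⟩ (suc x) = lookup-wedgeRight m Γ L x

lookup-unwrap : ∀ {m n} (σ : Sub (suc (suc m)) n) x →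
  lookupSub σ (suspVar x) ≡ lookupSub (unwrap σ) x
lookup-unwrap ⟨ σ , t ⟩ zero    = refl
lookup-unwrap ⟨ σ , t ⟩ (suc x) = lookup-unwrap σ x

-- A suspended type is never `⋆`, so the search passes every old variable and stops at the south
-- pole.
last₀-suspCtx : ∀ {n} (Γ : Ctx n) → last₀ (suspCtx Γ) ≡ inject₁ (fromℕ n)
last₀-suspCtx ∅                   = refl
last₀-suspCtx (Γ ▹ ⋆)             = cong suc (last₀-suspCtx Γ)
last₀-suspCtx (Γ ▹ (s ─⟨ A ⟩→ t)) = cong suc (last₀-suspCtx Γ)

sum-wedge : ∀ {k n} (φ : Tm n → ℕ) m (Γ : Ctx (suc k)) (L : Sub (suc (m + k)) n) →
  sumSub φ L + φ (lookupSub (wedgeLeft m L) (last₀ Γ)) ≡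
  sumSub φ (wedgeLeft m L) + sumSub φ (wedgeRight m Γ L)
sum-wedge φ zero    Γ L         = refl
sum-wedge φ (suc m) Γ ⟨ L , t ⟩ = begin
  sumSub φ L + φ t + x      ≡⟨ +-assoc (sumSub φ L) (φ t) x ⟩
  sumSub φ L + (φ t + x)    ≡⟨ cong (sumSub φ L +_) (+-comm (φ t) x) ⟩
  sumSub φ L + (x + φ t)    ≡⟨ +-assoc (sumSub φ L) x (φ t) ⟨
  sumSub φ L + x + φ t      ≡⟨ cong (_+ φ t) (sum-wedge φ m Γ L) ⟩
  l + r + φ t               ≡⟨ +-assoc l r (φ t) ⟩
  l + (r + φ t)             ∎
  where
  open ≡-Reasoning
  x = φ (lookupSub (wedgeLeft m L) (last₀ Γ))
  l = sumSub φ (wedgeLeft m L)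
  r = sumSub φ (wedgeRight m Γ L)

sum-unwrap : ∀ {m n} (φ : Tm n → ℕ) (σ : Sub (suc (suc m)) n) →
  sumSub φ σ ≡ φ (lookupSub σ (fromℕ (suc m))) + φ (lookupSub σ (inject₁ (fromℕ m)))
                 + sumSub φ (unwrap σ)
sum-unwrap {zero}  φ ⟨ ⟨ ⟨⟩ , s ⟩ , t ⟩ = sym (+-identityʳ _)
sum-unwrap {suc m} φ ⟨ σ , t ⟩ =
  trans (cong (_+ φ t) (sum-unwrap φ σ)) (+-assoc _ (sumSub φ (unwrap σ)) (φ t))

-- With `sum-toSub`, this translates between counts over entries and counts over paths. The wedge
-- point belongs to both halves, so its value `s` is added before cancelling.
sum-label : ∀ {n} (φ : Tm n → ℕ) T L → sumTree T (φ ∘ label T L) ≡ sumSub φ L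
sum-label φ []       ⟨ ⟨⟩ , t ⟩ = refl
sum-label φ (T ∷ Ts) L = +-cancelʳ-≡ s _ _ (begin
  φ (label (T ∷ Ts) L [ 0 ]) + sumTree T (φ ∘ label (T ∷ Ts) L ∘ (0 ∷_))
    + sumTree Ts (φ ∘ label (T ∷ Ts) L ∘ shift) + s
    ≡⟨ cong (_+ s) (cong₂ _+_ (cong₂ _+_
         (cong φ (lookup-wedgeLeft-first (size Ts) L))
         (trans (sumTree-cong T λ p → cong φ (label-first p)) (sum-label φ T (unwrap l))))
         (trans (sumTree-cong Ts λ p → cong φ (label-shift p)) (sum-label φ Ts r))) ⟩
  a + sumSub φ (unwrap l) + sumSub φ r + s
    ≡⟨ moveLeft a (sumSub φ (unwrap l)) (sumSub φ r) s ⟩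
  a + s + sumSub φ (unwrap l) + sumSub φ r
    ≡⟨ cong (λ x → a + φ (lookupSub l x) + sumSub φ (unwrap l) + sumSub φ r)
         (last₀-suspCtx ⌊ T ⌋) ⟩
  a + φ (lookupSub l (inject₁ (fromℕ _))) + sumSub φ (unwrap l) + sumSub φ r
    ≡⟨ cong (_+ sumSub φ r) (sum-unwrap φ l) ⟨
  sumSub φ l + sumSub φ r
    ≡⟨ sum-wedge φ (size Ts) Γ L ⟨
  sumSub φ L + s ∎)
  where
  open ≡-Reasoning
  Γ = suspCtx ⌊ T ⌋
  l = wedgeLeft (size Ts) L
  r = wedgeRight (size Ts) Γ L
  s = φ (lookupSub l (last₀ Γ))
  a = φ (lookupSub l (fromℕ _))
  moveLeft : ∀ a b c s → a + b + c + s ≡ a + s + b + c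
  moveLeft = solve-∀
  label-first : ∀ p → label (T ∷ Ts) L (0 ∷ p) ≡ label T (unwrap l) p
  label-first p = trans (lookup-wedgeLeft (size Ts) L _) (lookup-unwrap l (pathVar T p))
  label-shift : ∀ p → label (T ∷ Ts) L (shift p) ≡ label Ts r p
  label-shift [ j ]   = lookup-wedgeRight (size Ts) Γ L (pathVar Ts [ j ])
  label-shift (k ∷ p) = lookup-wedgeRight (size Ts) Γ L (pathVar Ts (k ∷ p))

-- Counting entries under insertion.

module _ {n} (φ : Tm n → ℕ) where

  insertTm-shift : ∀ k T (L M : Path → Tm n) p →
    insertTm [ suc k ] T L M (shift p) ≡ insertTm [ k ] T (L ∘ shift) M p
  insertTm-shift k T L M [ zero ] with 0 <ᵇ k
  ... | true  = refl
  ... | false = refl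
  insertTm-shift k T L M [ suc j ] with suc j <ᵇ k | j <ᵇ k + len T in eq
  ... | true  | _     = refl
  ... | false | true  = refl
  -- Truncated subtraction commutes with the successor once `len T ≤ suc j`, which the failed
  -- comparison supplies.
  ... | false | false = cong (λ i → L [ i + 1 ]) (+-∸-assoc 1 (len≤ eq))
    where
    len≤ : (j <ᵇ k + len T) ≡ false → len T ≤ suc j
    len≤ eq = ≤-trans (m≤n+m _ k) (m≤n⇒m≤1+n (≮⇒≥ λ j< → subst IsTrue eq (<⇒<ᵇ j<)))
  insertTm-shift k T L M (j ∷ p) with j <ᵇ k | j <ᵇ k + len T in eq
  ... | true  | _     = refl
  ... | false | true  = refl
  ... | false | false = cong (λ i → L (i + 1 ∷ p)) (+-∸-assoc 1 (len≤ eq))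
    where
    len≤ : (j <ᵇ k + len T) ≡ false → len T ≤ j
    len≤ eq = ≤-trans (m≤n+m _ k) (≮⇒≥ λ j< → subst IsTrue eq (<⇒<ᵇ j<))

  -- The last vertex of `T` and the first of `Ss` are glued and labelled by `M`, so `L [ 1 ]` is the
  -- one label over `Ss` that is lost.
  sum-append : ∀ T Ss (L M : Path → Tm n) →
    sumTree (T ++ Ss) (φ ∘ insertTm [ 0 ] T L M) + φ (L [ 1 ]) ≡
    sumTree T (φ ∘ M) + sumTree Ss (φ ∘ L ∘ shift)
  sum-append [] Ss L M =
    trans (sumTree-changeRoot Ss (φ ∘ insertTm [ 0 ] [] L M) (φ ∘ L ∘ shift)
             (λ j → cong (λ i → φ (L [ suc i ])) (+-comm j 1))
             (λ k p → cong (λ i → φ (L (i ∷ p))) (+-comm k 1)))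
          (+-comm (sumTree Ss (φ ∘ L ∘ shift)) _)
  sum-append (T ∷ Ts) Ss L M = begin
    a + b + sumTree (Ts ++ Ss) (φ ∘ insertTm [ 0 ] (T ∷ Ts) L M ∘ shift) + x
      ≡⟨ cong (λ c → a + b + c + x) (sumTree-cong (Ts ++ Ss) (cong φ ∘ shifted)) ⟩
    a + b + sumTree (Ts ++ Ss) (φ ∘ insertTm [ 0 ] Ts L (M ∘ shift)) + x
      ≡⟨ +-assoc (a + b) _ x ⟩
    a + b + (sumTree (Ts ++ Ss) (φ ∘ insertTm [ 0 ] Ts L (M ∘ shift)) + x)
      ≡⟨ cong (a + b +_) (sum-append Ts Ss L (M ∘ shift)) ⟩
    a + b + (sumTree Ts (φ ∘ M ∘ shift) + sumTree Ss (φ ∘ L ∘ shift))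
      ≡⟨ +-assoc (a + b) _ _ ⟨
    a + b + sumTree Ts (φ ∘ M ∘ shift) + sumTree Ss (φ ∘ L ∘ shift) ∎
    where
    open ≡-Reasoning
    a = φ (M [ 0 ])
    b = sumTree T (φ ∘ M ∘ (0 ∷_))
    x = φ (L [ 1 ])
    shifted : ∀ p → insertTm [ 0 ] (T ∷ Ts) L M (shift p) ≡ insertTm [ 0 ] Ts L (M ∘ shift) p
    shifted [ zero ]  = refl
    shifted [ suc j ] = refl
    shifted (k ∷ p)   = refl

  -- The entries of L ≪ M are entries of L and M, each used at most once, and
  -- the entry of L at the leaf of the branch is not among them.
  sum-insert : ∀ P S T (L M : Path → Tm n) →
    Branch S P → branchHeight P ≤ trunk T →
    sumTree (S ≪[ P ] T) (φ ∘ insertTm P T L M) + φ (L (lastPath S P)) ≤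
    sumTree S (φ ∘ L) + sumTree T (φ ∘ M)
  sum-insert [ zero ] (S ∷ Ss) T L M (_ , lin) _ = begin
    -- The linear child at the branch is discarded whole, and the leaf is one of its paths.
    i + y                 ≤⟨ +-monoʳ-≤ i (sumTree-leaf S (φ ∘ L ∘ (0 ∷_)) lin) ⟩
    i + b                 ≤⟨ m≤n+m (i + b) (a + x) ⟩
    a + x + (i + b)       ≡⟨ regroup a x i b ⟩
    a + b + (i + x)       ≡⟨ cong (a + b +_) (sum-append T Ss L M) ⟩
    a + b + (d + c)       ≡⟨ cong (a + b +_) (+-comm d c) ⟩
    a + b + (c + d)       ≡⟨ +-assoc (a + b) c d ⟨
    a + b + c + d         ∎
    where
    open ≤-Reasoning
    i = sumTree (T ++ Ss) (φ ∘ insertTm [ 0 ] T L M)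
    a = φ (L [ 0 ])
    b = sumTree S (φ ∘ L ∘ (0 ∷_))
    c = sumTree Ss (φ ∘ L ∘ shift)
    d = sumTree T (φ ∘ M)
    x = φ (L [ 1 ])
    y = φ (L (0 ∷ zeros (height S)))
    regroup : ∀ a x i b → a + x + (i + b) ≡ a + b + (i + x)
    regroup = solve-∀
  sum-insert [ suc k ] (S ∷ Ss) T L M (k< , lin) h = begin
    a + b + sumTree (Ss ≪[ [ k ] ] T) (φ ∘ insertTm [ suc k ] T L M ∘ shift) + y
      ≡⟨ cong (λ c → a + b + c + y)
           (sumTree-cong (Ss ≪[ [ k ] ] T) (cong φ ∘ insertTm-shift k T L M)) ⟩
    a + b + sumTree (Ss ≪[ [ k ] ] T) (φ ∘ insertTm [ k ] T (L ∘ shift) M) + y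
      ≡⟨ +-assoc (a + b) _ y ⟩
    a + b + (sumTree (Ss ≪[ [ k ] ] T) (φ ∘ insertTm [ k ] T (L ∘ shift) M) + y)
      ≤⟨ +-monoʳ-≤ (a + b) (sum-insert [ k ] Ss T (L ∘ shift) M (s≤s⁻¹ k< , lin) h) ⟩
    a + b + (sumTree Ss (φ ∘ L ∘ shift) + sumTree T (φ ∘ M))
      ≡⟨ +-assoc (a + b) _ _ ⟨
    a + b + sumTree Ss (φ ∘ L ∘ shift) + sumTree T (φ ∘ M) ∎
    where
    open ≤-Reasoning
    a = φ (L [ 0 ])
    b = sumTree S (φ ∘ L ∘ (0 ∷_))
    y = φ (L (lastPath (S ∷ Ss) [ suc k ]))
  sum-insert (zero ∷ Q) (S ∷ Ss) (T ∷ []) L M ((_ , ix) , lin) h = begin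
    m₀ + i + i′ + y     ≡⟨ regroup₁ m₀ i i′ y ⟩
    m₀ + i′ + (i + y)   ≤⟨ +-monoʳ-≤ (m₀ + i′)
                            (sum-insert Q S T (L ∘ (0 ∷_)) (M ∘ (0 ∷_)) (ix , lin) (below Q h)) ⟩
    -- `a` and `x` come from the labels of `L` at the two ends of the child, which those of `M`
    -- replace; they are the slack.
    m₀ + i′ + (b + t)   ≤⟨ m≤m+n _ (a + x) ⟩
    m₀ + i′ + (b + t) + (a + x)   ≡⟨ regroup₂ m₀ i′ b t a x ⟩
    a + b + (i′ + x) + (m₀ + t)   ≡⟨ cong (λ e → a + b + e + (m₀ + t)) root ⟩
    a + b + (c + m₁) + (m₀ + t)   ≡⟨ regroup₃ a b c m₁ m₀ t ⟩
    a + b + c + (m₀ + t + m₁)     ∎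
    where
    open ≤-Reasoning
    f = insertTm (0 ∷ Q) (T ∷ []) L M
    m₀ = φ (M [ 0 ])
    m₁ = φ (M [ 1 ])
    t = sumTree T (φ ∘ M ∘ (0 ∷_))
    i = sumTree (S ≪[ Q ] T) (φ ∘ f ∘ (0 ∷_))
    i′ = sumTree Ss (φ ∘ f ∘ shift)
    a = φ (L [ 0 ])
    b = sumTree S (φ ∘ L ∘ (0 ∷_))
    c = sumTree Ss (φ ∘ L ∘ shift)
    x = φ (L [ 1 ])
    y = φ (L (0 ∷ lastPath S Q))
    -- After the child, only the first vertex has its label changed, to that of `M`.
    root : i′ + x ≡ c + m₁
    root = sumTree-changeRoot Ss (φ ∘ f ∘ shift) (φ ∘ L ∘ shift) (λ _ → refl) (λ _ _ → refl)
    below : ∀ Q → length Q ≤ suc (trunk T) → branchHeight Q ≤ trunk T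
    below [ _ ]   (s≤s h) = h
    below (_ ∷ _) (s≤s h) = h
    regroup₁ : ∀ m i j y → m + i + j + y ≡ m + j + (i + y)
    regroup₁ = solve-∀
    regroup₂ : ∀ m j b t a x → m + j + (b + t) + (a + x) ≡ a + b + (j + x) + (m + t)
    regroup₂ = solve-∀
    regroup₃ : ∀ a b c n m t → a + b + (c + n) + (m + t) ≡ a + b + c + (m + t + n)
    regroup₃ = solve-∀
  -- A longer branch requires positive trunk, hence exactly one child; `Q` is split so that its
  -- length computes.
  sum-insert (zero ∷ [ _ ])   S []          L M _ ()
  sum-insert (zero ∷ (_ ∷ _)) S []          L M _ ()
  sum-insert (zero ∷ [ _ ])   S (_ ∷ _ ∷ _) L M _ ()
  sum-insert (zero ∷ (_ ∷ _)) S (_ ∷ _ ∷ _) L M _ ()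
  sum-insert (suc k ∷ Q) (S ∷ Ss) T L M ((k< , ix) , lin) h = begin
    a + b + sumTree (Ss ≪[ k ∷ Q ] T) (φ ∘ insertTm (suc k ∷ Q) T L M ∘ shift) + y
      ≡⟨ cong (λ c → a + b + c + y) (sumTree-cong (Ss ≪[ k ∷ Q ] T) (cong φ ∘ shifted)) ⟩
    a + b + sumTree (Ss ≪[ k ∷ Q ] T) (φ ∘ insertTm (k ∷ Q) T (L ∘ shift) M) + y
      ≡⟨ +-assoc (a + b) _ y ⟩
    a + b + (sumTree (Ss ≪[ k ∷ Q ] T) (φ ∘ insertTm (k ∷ Q) T (L ∘ shift) M) + y)
      ≤⟨ +-monoʳ-≤ (a + b) (sum-insert (k ∷ Q) Ss T (L ∘ shift) M ((s≤s⁻¹ k< , ix) , lin) h) ⟩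
    a + b + (sumTree Ss (φ ∘ L ∘ shift) + sumTree T (φ ∘ M))
      ≡⟨ +-assoc (a + b) _ _ ⟨
    a + b + sumTree Ss (φ ∘ L ∘ shift) + sumTree T (φ ∘ M) ∎
    where
    open ≤-Reasoning
    a = φ (L [ 0 ])
    b = sumTree S (φ ∘ L ∘ (0 ∷_))
    y = φ (L (lastPath (S ∷ Ss) (suc k ∷ Q)))
    shifted : ∀ p → insertTm (suc k ∷ Q) T L M (shift p) ≡ insertTm (k ∷ Q) T (L ∘ shift) M p
    shifted [ j ]   = refl
    shifted (j ∷ p) = refl

sum-insertLabelling : ∀ {n} (φ : Tm n → ℕ) S P T (L : Labelling S n) (M : Labelling T n) →
  InsertionPoint S P T →
  sumSub φ (insertLabelling S P T L M) + φ (label S L (lastPath S P)) ≤ sumSub φ L + sumSub φ M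
sum-insertLabelling φ S P T L M (branch , h , _) = begin
  sumSub φ (insertLabelling S P T L M) + φ (label S L (lastPath S P))
    ≡⟨ cong (_+ φ (label S L (lastPath S P))) (sum-toSub φ (S ≪[ P ] T) _) ⟩
  sumTree (S ≪[ P ] T) (φ ∘ insertTm P T (label S L) (label T M)) + φ (label S L (lastPath S P))
    ≤⟨ sum-insert φ P S T (label S L) (label T M) branch h ⟩
  sumTree S (φ ∘ label S L) + sumTree T (φ ∘ label T M)
    ≡⟨ cong₂ _+_ (sum-label φ S L) (sum-label φ T M) ⟩
  sumSub φ L + sumSub φ M ∎
  where open ≤-Reasoning

-- Decidable equality of syntax

_≟Ctx_ : ∀ {n} → DecidableEquality (Ctx n)
_≟Ty_  : ∀ {n} → DecidableEquality (Ty n)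
_≟Tm_  : ∀ {n} → DecidableEquality (Tm n)
_≟Sub_ : ∀ {m n} → DecidableEquality (Sub m n)

∅       ≟Ctx ∅       = yes refl
(Γ ▹ A) ≟Ctx (Δ ▹ B) =
  map′ (λ { (refl , refl) → refl }) (λ { refl → refl , refl }) (Γ ≟Ctx Δ ×-dec A ≟Ty B)

⋆             ≟Ty ⋆             = yes refl
⋆             ≟Ty (_ ─⟨ _ ⟩→ _) = no λ ()
(_ ─⟨ _ ⟩→ _) ≟Ty ⋆             = no λ ()
(s ─⟨ A ⟩→ t) ≟Ty (u ─⟨ B ⟩→ v) =
  map′ (λ { (refl , refl , refl) → refl }) (λ { refl → refl , refl , refl })
    (s ≟Tm u ×-dec A ≟Ty B ×-dec t ≟Tm v)

var x     ≟Tm var y     = map′ (cong var) (λ { refl → refl }) (x Fin.≟ y)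
var _     ≟Tm Coh _ _ _ = no λ ()
Coh _ _ _ ≟Tm var _     = no λ ()
Coh {m} Γ A σ ≟Tm Coh {m′} Δ B τ with m ≟ m′
... | no m≢m′  = no λ { refl → m≢m′ refl }
... | yes refl =
  map′ (λ { (refl , refl , refl) → refl }) (λ { refl → refl , refl , refl })
    (Γ ≟Ctx Δ ×-dec A ≟Ty B ×-dec σ ≟Sub τ)

⟨⟩        ≟Sub ⟨⟩        = yes refl
⟨ σ , s ⟩ ≟Sub ⟨ τ , t ⟩ =
  map′ (λ { (refl , refl) → refl }) (λ { refl → refl , refl }) (σ ≟Sub τ ×-dec s ≟Tm t)

-- Cells

-- The length is packed in so that cells over contexts of different lengths can be compared by `≡`.
Cell : Set
Cell = Σ[ m ∈ ℕ ] Ctx m × Ty m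

_≟Cell_ : DecidableEquality Cell
(m , Γ , A) ≟Cell (m′ , Δ , B) with m ≟ m′
... | no m≢m′  = no λ { refl → m≢m′ refl }
... | yes refl =
  map′ (λ { (refl , refl) → refl }) (λ { refl → refl , refl }) (Γ ≟Ctx Δ ×-dec A ≟Ty B)

dim-wkTy : ∀ {n} (A : Ty n) → dimTy (wkTy A) ≡ dimTy A
dim-wkTy ⋆             = refl
dim-wkTy (s ─⟨ A ⟩→ t) = cong suc (dim-wkTy A)

dim-wkTy² : ∀ {n} (A : Ty n) → dimTy (wkTy (wkTy A)) ≡ dimTy A
dim-wkTy² A = trans (dim-wkTy (wkTy A)) (dim-wkTy A)

dim-[] : ∀ {m n} (A : Ty m) (σ : Sub m n) → dimTy (A [ σ ]Ty) ≡ dimTy A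
dim-[] ⋆             σ = refl
dim-[] (s ─⟨ A ⟩→ t) σ = cong suc (dim-[] A σ)

dim-U : ∀ k → dimTy (U k) ≡ k
dim-U zero    = refl
dim-U (suc k) = cong suc (trans (dim-wkTy² (U k)) (dim-U k))

dim-Disc : ∀ n → dimCtx (Disc n) ≤ n
dim-Disc n = ⊔-lub (dim-Sphere n) (≤-reflexive (dim-U n))
  where
  dim-Sphere : ∀ n → dimCtx (Sphere n) ≤ n
  dim-Sphere zero    = z≤n
  dim-Sphere (suc n) =
    m≤n⇒m≤1+n (⊔-lub (dim-Disc n) (≤-reflexive (trans (dim-wkTy (U n)) (dim-U n))))

identityCell : ℕ → Cell
identityCell k = suc (k * 2) , Disc k , var zero ─⟨ wkTy (U k) ⟩→ var zero

-- The identity cell over `Disc k` has a type of dimension `suc k`, so `k` is read off from the type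
-- and the property is decidable without a search.
IsIdentityCell : ∀ {m} → Ctx m → Ty m → Set
IsIdentityCell Δ A = (_ , Δ , A) ≡ identityCell (dimTy A ∸ 1)

isIdentityCell? : ∀ {m} (Δ : Ctx m) A → Dec (IsIdentityCell Δ A)
isIdentityCell? Δ A = (_ , Δ , A) ≟Cell identityCell (dimTy A ∸ 1)

identityCell-isIdentityCell : ∀ k →
  IsIdentityCell (Disc k) (var zero ─⟨ wkTy (U k) ⟩→ var zero)
identityCell-isIdentityCell k =
  cong identityCell (sym (trans (dim-wkTy (U k)) (dim-U k)))

-- Raw types carry no typing constraint, so any `k * 2` terms can be stacked into a type.
sphereSub-surjective : ∀ {n} k (σ : Sub (k * 2) n) →
  Σ[ A ∈ Ty n ] Σ[ e ∈ dimTy A ≡ k ] subst (λ k → Sub (k * 2) n) e (sphereSub A) ≡ σ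
sphereSub-surjective zero    ⟨⟩                = ⋆ , refl , refl
sphereSub-surjective (suc k) ⟨ ⟨ σ , s ⟩ , t ⟩ with sphereSub-surjective k σ
... | A , refl , refl = s ─⟨ A ⟩→ t , refl , refl

-- Being an identity depends on the cell and not on the arguments, which lets `weight` be a function
-- of the cell.
isIdentityCell⇒isIdentity : ∀ {m n} {Δ : Ctx m} {A} (σ : Sub m n) →
  IsIdentityCell Δ A → IsIdentity (Coh Δ A σ)
-- The index is generalised to a variable so that the equation of cells can be matched with `refl`.
isIdentityCell⇒isIdentity {Δ = Δ} {A} σ = go (dimTy A ∸ 1) σ
  where
  go : ∀ {m n} {Δ : Ctx m} {A} k (σ : Sub m n) →
    (m , Δ , A) ≡ identityCell k → IsIdentity (Coh Δ A σ)
  go k ⟨ σ , t ⟩ refl with sphereSub-surjective k σ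
  ... | A , refl , refl = A , t , refl

weight : ∀ {m} → Ctx m → Ty m → ℕ
weight Δ A = if does (isIdentityCell? Δ A) then 1 else 2

weight≥1 : ∀ {m} (Δ : Ctx m) A → 1 ≤ weight Δ A
weight≥1 Δ A with isIdentityCell? Δ A
... | yes _ = s≤s z≤n
... | no _  = s≤s z≤n

weight≤2 : ∀ {m} (Δ : Ctx m) A → weight Δ A ≤ 2
weight≤2 Δ A with isIdentityCell? Δ A
... | yes _ = s≤s z≤n
... | no _  = ≤-refl

weight-identityCell : ∀ {m} {Δ : Ctx m} {A} → IsIdentityCell Δ A → weight Δ A ≡ 1
weight-identityCell {Δ = Δ} {A} id-cell rewrite dec-true (isIdentityCell? Δ A) id-cell = refl

weight-nonIdentityCell : ∀ {m} {Δ : Ctx m} {A} → ¬ IsIdentityCell Δ A → weight Δ A ≡ 2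
weight-nonIdentityCell {Δ = Δ} {A} ¬id-cell
  rewrite dec-false (isIdentityCell? Δ A) ¬id-cell = refl

-- Syntactic complexity

infix 4 _≼_ _≺_ _≺⟨_⟩_

-- For functions of finite support, `≺` is the order of the ordinals with these Cantor coefficients:
-- above `d` nothing grows, so the highest difference is a decrease.
_≼_ _≺_ : (ℕ → ℕ) → (ℕ → ℕ) → Set
f ≼ g = ∀ d → f d ≤ g d
f ≺ g = ∃[ d ] f d < g d × (∀ e → d < e → f e ≤ g e)

-- With infinite support `≺` is not well founded, so only the first `n` coefficients are compared.
_≺⟨_⟩_ : (ℕ → ℕ) → ℕ → (ℕ → ℕ) → Set
f ≺⟨ n ⟩ g = ∃[ d ] d < n × f d < g d × (∀ e → d < e → e < n → f e ≤ g e)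

monomial : ℕ → ℕ → ℕ → ℕ
monomial w e d = if does (d ≟ e) then w else 0

monomial-≡ : ∀ w {e d} → d ≡ e → monomial w e d ≡ w
monomial-≡ w {e} {d} d≡e rewrite dec-true (d ≟ e) d≡e = refl

monomial-≢ : ∀ w {e d} → d ≢ e → monomial w e d ≡ 0
monomial-≢ w {e} {d} d≢e rewrite dec-false (d ≟ e) d≢e = refl

monomial-mono : ∀ {v w e e′} → e ≡ e′ → v ≤ w → monomial v e ≼ monomial w e′
monomial-mono {e = e} refl v≤w d with does (d ≟ e)
... | true  = v≤w
... | false = z≤n

complexity    : ∀ {n} → Tm n → ℕ → ℕ
complexitySub : ∀ {m n} → Sub m n → ℕ → ℕ

-- The coefficient at d of the Cantor normal form of an ordinal below ω^ω.
complexity (var x)     d = 0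
complexity (Coh Δ A σ) d = monomial (weight Δ A) (dimTy A) d + complexitySub σ d

complexitySub ⟨⟩        d = 0
complexitySub ⟨ σ , t ⟩ d = complexitySub σ d + complexity t d

complexitySub-sum : ∀ {m n} d (σ : Sub m n) →
  complexitySub σ d ≡ sumSub (λ t → complexity t d) σ
complexitySub-sum d ⟨⟩        = refl
complexitySub-sum d ⟨ σ , t ⟩ = cong (_+ complexity t d) (complexitySub-sum d σ)

-- Lexicographic induction: either coefficient `n` does not grow while a lower one drops, or it
-- drops and the lower ones start afresh.
≺⟨⟩-wellFounded : ∀ n f → Acc _≺⟨ n ⟩_ f
≺⟨⟩-wellFounded zero    f = acc λ { (_ , () , _) }
≺⟨⟩-wellFounded (suc n) f = go (<-wellFounded (f n)) (≺⟨⟩-wellFounded n f) ≤-refl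
  where
  -- `v` merely bounds `f n`: a drop at a lower index may also decrease `f n`, and the same `v`
  -- still serves.
  go : ∀ {v f} → Acc _<_ v → Acc _≺⟨ n ⟩_ f → f n ≤ v → Acc _≺⟨ suc n ⟩_ f
  go {f = f} (acc rv) (acc rf) f≤v = acc λ {g} (d , d<1+n , g<f , g≤f) →
    [ (λ d<n → go (acc rv) (rf (d , d<n , g<f , λ e d<e e<n → g≤f e d<e (m≤n⇒m≤1+n e<n)))
                 (≤-trans (g≤f n d<n ≤-refl) f≤v))
    , (λ d≡n → go (rv (<-≤-trans (subst (λ e → g e < f e) d≡n g<f) f≤v))
                 (≺⟨⟩-wellFounded n g) ≤-refl)
    ]′ (m≤n⇒m<n∨m≡n (s≤s⁻¹ d<1+n))

+-≺ˡ : ∀ {f g} (h : ℕ → ℕ) → f ≺ g → (λ d → f d + h d) ≺ (λ d → g d + h d)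
+-≺ˡ {f} {g} h (d , f<g , f≤g) = d , +-monoˡ-< (h d) f<g , λ e d<e → +-monoˡ-≤ (h e) (f≤g e d<e)

+-≺ʳ : ∀ {f g} (h : ℕ → ℕ) → f ≺ g → (λ d → h d + f d) ≺ (λ d → h d + g d)
+-≺ʳ {f} {g} h (d , f<g , f≤g) = d , +-monoʳ-< (h d) f<g , λ e d<e → +-monoʳ-≤ (h e) (f≤g e d<e)

-- Variables of a pasting context

dimVar : ∀ {n} → Ctx n → Fin n → ℕ
dimVar Γ x = dimTy (lookupCtx Γ x)

dimVar≤dimCtx : ∀ {n} (Γ : Ctx n) x → dimVar Γ x ≤ dimCtx Γ
dimVar≤dimCtx (Γ ▹ A) zero    = ≤-trans (≤-reflexive (dim-wkTy A)) (m≤n⊔m _ _)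
dimVar≤dimCtx (Γ ▹ A) (suc x) =
  ≤-trans (≤-reflexive (dim-wkTy (lookupCtx Γ x))) (≤-trans (dimVar≤dimCtx Γ x) (m≤m⊔n _ _))

data Globular {n} (Γ : Ctx n) : Ty n → Set where
  ⋆   : Globular Γ ⋆
  arr : ∀ {x A y} → dimVar Γ x ≡ dimTy A → Globular Γ A → dimVar Γ y ≡ dimTy A →
        Globular Γ (var x ─⟨ A ⟩→ var y)

globular-wk : ∀ {n} {Γ : Ctx n} {A} B → Globular Γ A → Globular (Γ ▹ B) (wkTy A)
globular-wk B ⋆ = ⋆
globular-wk {Γ = Γ} B (arr {x} {A} {y} dx gA dy) =
  arr (dim-suc x dx) (globular-wk B gA) (dim-suc y dy)
  where
  dim-suc : ∀ z → dimVar Γ z ≡ dimTy A → dimVar (Γ ▹ B) (suc z) ≡ dimTy (wkTy A)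
  dim-suc z dz = trans (dim-wkTy (lookupCtx Γ z)) (trans dz (sym (dim-wkTy A)))

globular-FV : ∀ {n} {Γ : Ctx n} {A} → Globular Γ A → ∀ {y} → y ∈ FVTy A → dimVar Γ y ≤ dimTy A
globular-FV ⋆ y∈ = contradiction y∈ ∉⊥
globular-FV {Γ = Γ} (arr {u} {A} {v} du gA dv) {y} y∈ with x∈p∪q⁻ ⁅ u ⁆ (FVTy A ∪ ⁅ v ⁆) y∈
... | inj₁ y∈u rewrite x∈⁅y⁆⇒x≡y u y∈u = m≤n⇒m≤1+n (≤-reflexive du)
... | inj₂ y∈′ with x∈p∪q⁻ (FVTy A) ⁅ v ⁆ y∈′
...   | inj₁ y∈A = m≤n⇒m≤1+n (globular-FV gA y∈A)
...   | inj₂ y∈v rewrite x∈⁅y⁆⇒x≡y v y∈v = m≤n⇒m≤1+n (≤-reflexive dv)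

-- Both parts are proved together, since after `ps-↓` the dimension of the new variable is read off
-- from the globularity of the old type.
ps-dim : ∀ {n} {Γ : Ctx n} {x A} → Γ ⊢ps x ∶ A → dimVar Γ x ≡ dimTy A × Globular Γ A
ps-dim ps-⋆ = refl , ⋆
ps-dim (ps-ext {Γ = Γ} {x} {A} d) = let dx , gA = ps-dim d in
  refl , globular-wk _ (arr (trans (dim-wkTy (lookupCtx Γ x)) (trans dx (sym (dim-wkTy A))))
                            (globular-wk _ gA) refl)
ps-dim (ps-↓ d) with ps-dim d
... | _ , arr _ gA dy = dy , gA

ps-globular : ∀ {n} {Γ : Ctx n} {x A} → Γ ⊢ps x ∶ A → ∀ z → Globular Γ (lookupCtx Γ z)
ps-globular ps-⋆       zero          = ⋆
ps-globular (ps-ext d) zero          = proj₂ (ps-dim (ps-ext d))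
ps-globular (ps-ext d) (suc zero)    = globular-wk _ (globular-wk _ (proj₂ (ps-dim d)))
ps-globular (ps-ext d) (suc (suc z)) = globular-wk _ (globular-wk _ (ps-globular d z))
ps-globular (ps-↓ d)   z             = ps-globular d z

ps-dim≤dimCtx : ∀ {n} {Γ : Ctx n} {x A} → Γ ⊢ps x ∶ A → dimTy A ≤ dimCtx Γ
ps-dim≤dimCtx {Γ = Γ} {x} d =
  ≤-trans (≤-reflexive (sym (proj₁ (ps-dim d)))) (dimVar≤dimCtx Γ x)

-- Extension never removes a variable from a source boundary, so an old witness survives; the new
-- top variable replaces it when it is included and at least as large as the old context's
-- dimension.
boundary-dim : ∀ {n} {Γ : Ctx n} {x A} i (d : Γ ⊢ps x ∶ A) →
  ∃[ z ] z ∈ boundary i ⊖ d × i ⊓ dimCtx Γ ≤ dimVar Γ z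
boundary-dim i ps-⋆ = zero , here , m⊓n≤n i 0
boundary-dim i (ps-↓ d) = boundary-dim i d
boundary-dim i (ps-ext {Γ = Γ} {x} {A} d) = extend (boundary-dim i d)
  where
  Γ′ = Γ ▹ A ▹ var (suc x) ─⟨ wkTy A ⟩→ var zero
  weaken : ∀ z → i ⊓ dimCtx Γ′ ≤ dimVar Γ z → i ⊓ dimCtx Γ′ ≤ dimVar Γ′ (suc (suc z))
  weaken z = subst (i ⊓ dimCtx Γ′ ≤_) (sym (dim-wkTy² (lookupCtx Γ z)))
  -- Here `i` is at most the dimension of the old context, so the old minimum is already `i`.
  low : ∀ {m} → i ≤ dimTy A → i ⊓ dimCtx Γ ≤ m → i ⊓ dimCtx Γ′ ≤ m
  low {m} i≤A i≤m = begin
    i ⊓ dimCtx Γ′   ≤⟨ m⊓n≤m i _ ⟩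
    i               ≡⟨ m≤n⇒m⊓n≡m (≤-trans i≤A (ps-dim≤dimCtx d)) ⟨
    i ⊓ dimCtx Γ    ≤⟨ i≤m ⟩
    m               ∎
    where open ≤-Reasoning
  dimΓ′≤ : ∀ {k} → dimCtx Γ ≤ k → suc (dimTy A) ≤ k → dimCtx Γ′ ≤ k
  dimΓ′≤ Γ≤k A<k =
    ⊔-lub (⊔-lub Γ≤k (<⇒≤ A<k)) (≤-trans (≤-reflexive (cong suc (dim-wkTy A))) A<k)
  extend : ∃[ z ] z ∈ boundary i ⊖ d × i ⊓ dimCtx Γ ≤ dimVar Γ z →
    ∃[ z ] z ∈ boundary i ⊖ (ps-ext d) × i ⊓ dimCtx Γ′ ≤ dimVar Γ′ z
  extend (z , z∈ , i≤z) with <-cmp i (dimTy A)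
  ... | tri< i<A _ _ = suc (suc z) , there (there z∈) , weaken z (low (<⇒≤ i<A) i≤z)
  ... | tri≈ _ i≡A _ = suc (suc z) , there (there z∈) , weaken z (low (≤-reflexive i≡A) i≤z)
  ... | tri> _ _ _ with ≤-total (dimCtx Γ) (suc (dimTy A))
  ...   | inj₁ Γ≤1+A = zero , here ,
    ≤-trans (m⊓n≤n i _)
      (≤-trans (dimΓ′≤ Γ≤1+A ≤-refl) (≤-reflexive (cong suc (sym (dim-wkTy² A)))))
  ...   | inj₂ 1+A≤Γ = suc (suc z) , there (there z∈) ,
    weaken z (≤-trans (⊓-monoʳ-≤ i (dimΓ′≤ ≤-refl 1+A≤Γ)) i≤z)

-- A closure step leads to a variable in the type of another, whose dimension is no larger by
-- globularity.
closure-dim : ∀ {n} {Δ : Ctx n} {V} {k} → PsCtx Δ → (∀ {x} → x ∈ V → dimVar Δ x ≤ k) →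
  ∀ {x} → Closure Δ V x → dimVar Δ x ≤ k
closure-dim psΔ V≤k (base x∈V) = V≤k x∈V
closure-dim (ps d) V≤k (step {x} c y∈) =
  ≤-trans (globular-FV (ps-globular d x) y∈) (closure-dim (ps d) V≤k c)

-- The support of `s` is a source boundary of level at least `dimCtx Δ ∸ 1`, and so contains a
-- variable of at least that dimension.
regular-dim : ∀ {n} {Δ : Ctx n} {s : Tm n} {V k} → Regular Δ (Supp Δ s) V →
  (∀ {x} → x ∈ FVTm s → dimVar Δ x ≤ k) → dimCtx Δ ≤ suc k
regular-dim {Δ = Δ} {k = k} (regular (ps d) i Δ≤i (_ , ∂⊆s) _) s≤k with boundary-dim i d
... | z , z∈ , i≤z = ≤-trans (m≤n+m∸n (dimCtx Δ) 1) (s≤s (begin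
  dimCtx Δ ∸ 1              ≤⟨ ⊓-glb Δ≤i (m∸n≤m (dimCtx Δ) 1) ⟩
  i ⊓ dimCtx Δ              ≤⟨ i≤z ⟩
  dimVar Δ z                ≤⟨ closure-dim (ps d) s≤k (∂⊆s z∈) ⟩
  k                         ∎))
  where open ≤-Reasoning

-- Dimension bounds for well-formed terms.

module _ {ℛ : RuleSet} where
  open Catt ℛ

  dim-≈ : ∀ {n} {Γ : Ctx n} {A B} → Γ ⊢ A ≈ty B → dimTy A ≡ dimTy B
  dim-≈ ≈-⋆           = refl
  dim-≈ (≈-→ _ A≈B _) = cong suc (dim-≈ A≈B)

  -- The variables of a coherence are those of its arguments, bounded by the dimension of the cell's
  -- context; regularity bounds that by the cell's own dimension, using the claim for its source.
  FV-dim-tm : ∀ {n} {Γ : Ctx n} {t A} → Γ ⊢tm t ∶ A → ∀ {x} → x ∈ FVTm t → dimVar Γ x ≤ dimTy A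
  FV-dim-sub : ∀ {m n} {Γ : Ctx n} {Δ : Ctx m} {σ} → Γ ⊢sub σ ∶ Δ →
    ∀ {x} → x ∈ FVSub σ → dimVar Γ x ≤ dimCtx Δ
  cell-dim : ∀ {n} {Δ : Ctx n} {s A t V} → Δ ⊢ty (s ─⟨ A ⟩→ t) →
    Regular Δ (Supp Δ s) V → dimCtx Δ ≤ suc (dimTy A)

  FV-dim-tm (tm-var y) x∈ rewrite x∈⁅y⁆⇒x≡y y x∈ = ≤-refl
  FV-dim-tm (tm-conv ⊢t A≈B) x∈ = ≤-trans (FV-dim-tm ⊢t x∈) (≤-reflexive (dim-≈ A≈B))
  FV-dim-tm (tm-coh {A = A} {σ = σ} _ ⊢A ⊢σ reg) x∈ =
    ≤-trans (FV-dim-sub ⊢σ x∈)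
      (≤-trans (cell-dim ⊢A reg) (≤-reflexive (cong suc (sym (dim-[] A σ)))))

  FV-dim-sub sub-⟨⟩ x∈ = contradiction x∈ ∉⊥
  FV-dim-sub (sub-, {σ = σ} {t} {A} ⊢σ ⊢t) x∈ with x∈p∪q⁻ (FVSub σ) (FVTm t) x∈
  ... | inj₁ x∈σ = ≤-trans (FV-dim-sub ⊢σ x∈σ) (m≤m⊔n _ _)
  ... | inj₂ x∈t = ≤-trans (FV-dim-tm ⊢t x∈t) (≤-trans (≤-reflexive (dim-[] A σ)) (m≤n⊔m _ _))

  cell-dim {s = s} (ty-→ _ ⊢s _) reg = regular-dim {s = s} reg (FV-dim-tm ⊢s)

  -- Arguments are typed over a context of dimension at most that of the cell, so no coherence
  -- nested in them exceeds it.
  complexity-bound : ∀ {n} {Γ : Ctx n} {t A} → Γ ⊢tm t ∶ A →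
    ∀ {d} → dimTy A < d → complexity t d ≡ 0
  complexitySub-bound : ∀ {m n} {Γ : Ctx n} {Δ : Ctx m} {σ} → Γ ⊢sub σ ∶ Δ →
    ∀ {d} → dimCtx Δ < d → complexitySub σ d ≡ 0

  complexity-bound (tm-var x) A<d = refl
  complexity-bound (tm-conv ⊢t A≈B) A<d = complexity-bound ⊢t (subst (_< _) (sym (dim-≈ A≈B)) A<d)
  complexity-bound (tm-coh {A = A} {σ = σ} _ ⊢A ⊢σ reg) {d} A<d =
    cong₂ _+_ (monomial-≢ _ (≢-sym (<⇒≢ 1+A<d)))
      (complexitySub-bound ⊢σ (≤-<-trans (cell-dim ⊢A reg) 1+A<d))
    where
    1+A<d : suc (dimTy A) < d
    1+A<d = subst (λ k → suc k < d) (dim-[] A σ) A<d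

  complexitySub-bound sub-⟨⟩ Δ<d = refl
  complexitySub-bound (sub-, {Δ = Δ} {σ} {A = A} ⊢σ ⊢t) Δ<d =
    cong₂ _+_ (complexitySub-bound ⊢σ (≤-<-trans (m≤m⊔n _ _) Δ<d))
      (complexity-bound ⊢t (subst (_< _) (sym (dim-[] A σ)) (≤-<-trans (m≤n⊔m (dimCtx Δ) _) Δ<d)))

  coh-inversion : ∀ {m n} {Γ : Ctx n} {Δ : Ctx m} {A σ B} →
    Γ ⊢tm Coh Δ A σ ∶ B → Δ ⊢ty A × Γ ⊢sub σ ∶ Δ
  coh-inversion (tm-conv ⊢t _)      = coh-inversion ⊢t
  coh-inversion (tm-coh _ ⊢A ⊢σ _) = ⊢A , ⊢σ

  dim-⟶ : ∀ {n} {Γ : Ctx n} {A B} → Γ ⊢ A ⟶ty B → dimTy A ≡ dimTy B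
  dim-⟶ (src _)  = refl
  dim-⟶ (type p) = cong suc (dim-⟶ p)
  dim-⟶ (tgt _)  = refl

-- Complexity of reducts

[]-wk-tm  : ∀ {m n} (t : Tm m) (σ : Sub m n) u → wkTm t [ ⟨ σ , u ⟩ ]Tm ≡ t [ σ ]Tm
[]-wk-sub : ∀ {l m n} (τ : Sub l m) (σ : Sub m n) u → wkSub τ ● ⟨ σ , u ⟩ ≡ τ ● σ
[]-wk-tm (var x)     σ u = refl
[]-wk-tm (Coh Δ A τ) σ u = cong (Coh Δ A) ([]-wk-sub τ σ u)
[]-wk-sub ⟨⟩        σ u = refl
[]-wk-sub ⟨ τ , t ⟩ σ u = cong₂ ⟨_,_⟩ ([]-wk-sub τ σ u) ([]-wk-tm t σ u)

idSub-● : ∀ {m n} (σ : Sub m n) → idSub ● σ ≡ σ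
idSub-● ⟨⟩        = refl
idSub-● ⟨ σ , t ⟩ = cong ⟨_, t ⟩ (trans ([]-wk-sub idSub σ t) (idSub-● σ))

-- The labelling gains at most the arguments `M` and loses the leaf, which counts `M` and its own
-- head. The arguments cancel; the head remains as the loss.
complexity-insert : ∀ {n} S P T (L : Labelling S n) (M : Labelling T n) →
  InsertionRedex S P T L M →
  let h = leafHeight S P in ∀ d →
  complexitySub (insertLabelling S P T L M) d + monomial (weight ⌊ T ⌋ (𝒰 h T)) (dimTy (𝒰 h T)) d
    ≤ complexitySub L d
complexity-insert S P T L M (point , leaf) d = +-cancelʳ-≤ (complexitySub M d) _ _ (begin
  complexitySub (insertLabelling S P T L M) d + w + complexitySub M d
    ≡⟨ +-assoc (complexitySub (insertLabelling S P T L M) d) w _ ⟩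
  complexitySub (insertLabelling S P T L M) d + (w + complexitySub M d)
    ≡⟨ cong (λ σ → complexitySub (insertLabelling S P T L M) d + (w + complexitySub σ d))
         (idSub-● M) ⟨
  complexitySub (insertLabelling S P T L M) d + complexity (𝒞 h T [ M ]Tm) d
    ≡⟨ cong₂ _+_ (complexitySub-sum d (insertLabelling S P T L M))
         (cong φ (sym leaf)) ⟩
  sumSub φ (insertLabelling S P T L M) + φ (label S L (lastPath S P))
    ≤⟨ sum-insertLabelling φ S P T L M point ⟩
  sumSub φ L + sumSub φ M
    ≡⟨ cong₂ _+_ (complexitySub-sum d L) (complexitySub-sum d M) ⟨
  complexitySub L d + complexitySub M d ∎)
  where
  open ≤-Reasoning
  h = leafHeight S P
  w = monomial (weight ⌊ T ⌋ (𝒰 h T)) (dimTy (𝒰 h T)) d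
  φ : Tm _ → ℕ
  φ t = complexity t d

open Catt sua′

coh-positive : ∀ {m} (Δ : Ctx m) A → 1 ≤ monomial (weight Δ A) (dimTy A) (dimTy A)
coh-positive Δ A =
  subst (1 ≤_) (sym (monomial-≡ (weight Δ A) {dimTy A} refl)) (weight≥1 Δ A)

-- The strict drop is at the dimension of the coherence that is removed or replaced: the disc, the
-- endo-coherence, or the leaf of the branch.
rule-≺ : ∀ {n} {Γ : Ctx n} {t t′} → sua′ Γ t t′ → WellFormed Γ t′ → complexity t′ ≺ complexity t
rule-≺ (inj₁ (disc-removal A t)) _ =
  dimTy disc , +-mono-≤ (coh-positive (Disc (dimTy A)) disc) (t≼args (dimTy disc)) ,
  λ d _ → m≤n⇒m≤o+n (monomial (weight (Disc (dimTy A)) disc) (dimTy disc) d) (t≼args d)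
  where
  disc = wkTy (U (dimTy A))
  t≼args : complexity t ≼ complexitySub (discSub A t)
  t≼args d = m≤n+m (complexity t d) (complexitySub (sphereSub A) d)
-- A well-formed reduct has all its arguments of dimension at most dim A, so the
-- endpoints may mention the arguments of the redex any number of times.
rule-≺ (inj₂ (inj₁ (endo-coherence-removal Δ s A σ ¬id))) (_ , ⊢id) =
  suc (dimTy A) , at-top , above
  where
  open ≤-Reasoning
  k = dimTy (A [ σ ]Ty)
  idType = var zero ─⟨ wkTy (U k) ⟩→ var zero
  cell-dim≡ : suc (dimTy (wkTy (U k))) ≡ suc (dimTy A)
  cell-dim≡ = cong suc (trans (dim-wkTy (U k)) (trans (dim-U k) (dim-[] A σ)))
  args-bound : ∀ {d} → dimTy A < d → complexitySub (discSub (A [ σ ]Ty) (s [ σ ]Tm)) d ≡ 0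
  args-bound A<d = complexitySub-bound (proj₂ (coh-inversion ⊢id))
    (≤-<-trans (≤-trans (dim-Disc k) (≤-reflexive (dim-[] A σ))) A<d)
  at-top : suc (complexity (identity (A [ σ ]Ty) (s [ σ ]Tm)) (suc (dimTy A)))
             ≤ complexity (Coh Δ (s ─⟨ A ⟩→ s) σ) (suc (dimTy A))
  at-top = begin
    suc (complexity (identity (A [ σ ]Ty) (s [ σ ]Tm)) (suc (dimTy A)))
      ≡⟨ cong suc (cong₂ _+_
           (trans (monomial-≡ (weight (Disc k) idType) (sym cell-dim≡))
              (weight-identityCell (identityCell-isIdentityCell k)))
           (args-bound ≤-refl)) ⟩
    2
      ≡⟨ trans (monomial-≡ (weight Δ (s ─⟨ A ⟩→ s)) {suc (dimTy A)} refl)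
           (weight-nonIdentityCell (¬id ∘ isIdentityCell⇒isIdentity σ)) ⟨
    monomial (weight Δ (s ─⟨ A ⟩→ s)) (suc (dimTy A)) (suc (dimTy A))
      ≤⟨ m≤m+n _ _ ⟩
    complexity (Coh Δ (s ─⟨ A ⟩→ s) σ) (suc (dimTy A)) ∎
  above : ∀ d → suc (dimTy A) < d →
    complexity (identity (A [ σ ]Ty) (s [ σ ]Tm)) d ≤ complexity (Coh Δ (s ─⟨ A ⟩→ s) σ) d
  above d A<d = ≤-trans
    (≤-reflexive (cong₂ _+_
      (monomial-≢ (weight (Disc k) idType) (>⇒≢ (≤-<-trans (≤-reflexive cell-dim≡) A<d)))
      (args-bound (<-trans (n<1+n _) A<d))))
    z≤n
rule-≺ (inj₂ (inj₂ (insertion S P T L M A redex ¬id _ _))) _ =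
  e , <-≤-trans at-leaf (+-mono-≤ (head≤ e) (complexity-insert S P T L M redex e)) ,
  λ d _ → +-mono-≤ (head≤ d)
    (m+n≤o⇒m≤o (complexitySub L≪M d) (complexity-insert S P T L M redex d))
  where
  leaf = 𝒰 (leafHeight S P) T
  e = dimTy leaf
  L≪M = insertLabelling S P T L M
  head head′ : ℕ → ℕ
  head = monomial (weight ⌊ S ⌋ A) (dimTy A)
  head′ = monomial (weight ⌊ S ≪[ P ] T ⌋ (A [ κ S P T ]Ty)) (dimTy (A [ κ S P T ]Ty))
  -- The redex is not an identity, so its head already has the maximal weight 2.
  head≤ : head′ ≼ head
  head≤ = monomial-mono (dim-[] A (κ S P T))
    (≤-trans (weight≤2 ⌊ S ≪[ P ] T ⌋ (A [ κ S P T ]Ty))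
      (≤-reflexive (sym (weight-nonIdentityCell (¬id ∘ isIdentityCell⇒isIdentity L)))))
  at-leaf : head′ e + complexitySub L≪M e
              < head′ e + (complexitySub L≪M e + monomial (weight ⌊ T ⌋ leaf) e e)
  at-leaf = +-monoʳ-< (head′ e) (m<m+n (complexitySub L≪M e) (coh-positive ⌊ T ⌋ leaf))

-- Reduction steps inside cells

data VariableTy {n} : Ty n → Set where
  ⋆   : VariableTy ⋆
  arr : ∀ {x A y} → VariableTy A → VariableTy (var x ─⟨ A ⟩→ var y)

variableTy-wk : ∀ {n} {A : Ty n} → VariableTy A → VariableTy (wkTy A)
variableTy-wk ⋆       = ⋆
variableTy-wk (arr v) = arr (variableTy-wk v)

variableTy-U : ∀ k → VariableTy (U k)
variableTy-U zero    = ⋆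
variableTy-U (suc k) = arr (variableTy-wk (variableTy-wk (variableTy-U k)))

var-irreducible : ∀ {n} {Γ : Ctx n} {x t} → ¬ Γ ⊢ var x ⟶tm t
var-irreducible (rule (inj₁ ()))
var-irreducible (rule (inj₂ (inj₁ ())))
var-irreducible (rule (inj₂ (inj₂ ())))

variableTy-irreducible : ∀ {n} {Γ : Ctx n} {A B} → VariableTy A → ¬ Γ ⊢ A ⟶ty B
variableTy-irreducible (arr v) (src p)  = var-irreducible p
variableTy-irreducible (arr v) (type p) = variableTy-irreducible v p
variableTy-irreducible (arr v) (tgt p)  = var-irreducible p

identityCell-irreducible : ∀ {m} {Δ : Ctx m} {A B} k →
  (m , Δ , A) ≡ identityCell k → ¬ Δ ⊢ A ⟶ty B
identityCell-irreducible k refl =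
  variableTy-irreducible (arr (variableTy-wk (variableTy-U k)))

-- Only an identity cell could gain weight, but its type is built from variables and does not
-- reduce.
weight-⟶ : ∀ {m} {Δ : Ctx m} {A B} → Δ ⊢ A ⟶ty B → weight Δ B ≤ weight Δ A
weight-⟶ {Δ = Δ} {A} {B} p = ≤-trans (weight≤2 Δ B)
  (≤-reflexive (sym (weight-nonIdentityCell λ id-cell → identityCell-irreducible _ id-cell p)))

infix 4 _⊢_⇝ty_ _⟿_ _⟿sub_

_⊢_⇝ty_ : ∀ {n} → Ctx n → Ty n → Ty n → Set
Γ ⊢ A ⇝ty B = Γ ⊢ty A × Γ ⊢ty B × Γ ⊢ A ⟶ty B

-- The steps inside a cell, at any depth of arguments. Typing is recorded for the cell alone, so the
-- ambient context does not appear.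
data _⟿_ {n} : Tm n → Tm n → Set
data _⟿sub_ {n} : ∀ {m} → Sub m n → Sub m n → Set

data _⟿_ where
  cell : ∀ {m} {Δ : Ctx m} {A B σ} → Δ ⊢ A ⇝ty B → Coh Δ A σ ⟿ Coh Δ B σ
  args : ∀ {m} {Δ : Ctx m} {A σ τ} → σ ⟿sub τ → Coh Δ A σ ⟿ Coh Δ A τ

data _⟿sub_ where
  init : ∀ {m} {σ τ : Sub m _} {t} → σ ⟿sub τ → ⟨ σ , t ⟩ ⟿sub ⟨ τ , t ⟩
  last : ∀ {m} {σ : Sub m _} {s t} → s ⟿ t → ⟨ σ , s ⟩ ⟿sub ⟨ σ , t ⟩

-- Followed through the arguments, a step ends either at a rule, with a strict drop, or in a cell,
-- whose dimension is kept and whose weight does not grow.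
step-complexity : ∀ {n} {Γ : Ctx n} {t t′} → WellFormed Γ t → WellFormed Γ t′ → Γ ⊢ t ⟶tm t′ →
  complexity t′ ≺ complexity t ⊎ (t ⟿ t′ × complexity t′ ≼ complexity t)
step-complexitySub : ∀ {m n} {Γ : Ctx n} {Δ : Ctx m} {σ τ} →
  Γ ⊢sub σ ∶ Δ → Γ ⊢sub τ ∶ Δ → Γ ⊢ σ ⟶sub τ →
  complexitySub τ ≺ complexitySub σ ⊎ (σ ⟿sub τ × complexitySub τ ≼ complexitySub σ)

step-complexity _ wt′ (rule r) = inj₁ (rule-≺ r wt′)
step-complexity (_ , ⊢t) (_ , ⊢t′) (cell {Δ = Δ} {A} {B} {σ} p) =
  inj₂ (cell (proj₁ (coh-inversion ⊢t) , proj₁ (coh-inversion ⊢t′) , p) ,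
        λ d → +-monoˡ-≤ (complexitySub σ d) (head≤ d))
  where
  head≤ : ∀ d → monomial (weight Δ B) (dimTy B) d ≤ monomial (weight Δ A) (dimTy A) d
  head≤ = monomial-mono (sym (dim-⟶ p)) (weight-⟶ p)
step-complexity (_ , ⊢t) (_ , ⊢t′) (args {Δ = Δ} {A} p) =
  Sum.map (+-≺ʳ head) (λ (q , τ≼σ) → args q , λ d → +-monoʳ-≤ (head d) (τ≼σ d))
    (step-complexitySub (proj₂ (coh-inversion ⊢t)) (proj₂ (coh-inversion ⊢t′)) p)
  where head = monomial (weight Δ A) (dimTy A)

step-complexitySub (sub-, ⊢σ _) (sub-, ⊢τ _) (init {t = t} p) =
  Sum.map (+-≺ˡ (complexity t)) (λ (q , τ≼σ) → init q , λ d → +-monoˡ-≤ (complexity t d) (τ≼σ d))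
    (step-complexitySub ⊢σ ⊢τ p)
step-complexitySub (sub-, _ ⊢s) (sub-, _ ⊢t) (last {σ = σ} p) =
  Sum.map (+-≺ʳ (complexitySub σ))
    (λ (q , t≼s) → last q , λ d → +-monoʳ-≤ (complexitySub σ d) (t≼s d))
    (step-complexity (_ , ⊢s) (_ , ⊢t) p)

-- Accessibility

SN : ∀ {n} → Ctx n → Tm n → Set
SN Γ = Acc (flip (Γ ⊢_⇝_))

SNTy : ∀ {n} → Ctx n → Ty n → Set
SNTy Γ = Acc (flip (Γ ⊢_⇝ty_))

sn-arrow : ∀ {n} {Γ : Ctx n} {s A t} → SN Γ s → SNTy Γ A → SN Γ t → SNTy Γ (s ─⟨ A ⟩→ t)
sn-arrow (acc rs) (acc rA) (acc rt) = acc λ where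
  (ty-→ _ ⊢s _ , ty-→ _ ⊢s′ _ , src p)  → sn-arrow (rs ((_ , ⊢s) , (_ , ⊢s′) , p)) (acc rA) (acc rt)
  (ty-→ ⊢A _ _ , ty-→ ⊢A′ _ _ , type p) → sn-arrow (acc rs) (rA (⊢A , ⊢A′ , p)) (acc rt)
  (ty-→ _ _ ⊢t , ty-→ _ _ ⊢t′ , tgt p)  → sn-arrow (acc rs) (acc rA) (rt ((_ , ⊢t) , (_ , ⊢t′) , p))

⟿-acc-coh : ∀ {m n} {Δ : Ctx m} {A} {σ : Sub m n} →
  SNTy Δ A → Acc (flip _⟿sub_) σ → Acc (flip _⟿_) (Coh Δ A σ)
⟿-acc-coh (acc rA) (acc rσ) = acc λ where
  (cell p) → ⟿-acc-coh (rA p) (acc rσ)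
  (args p) → ⟿-acc-coh (acc rA) (rσ p)

⟿-acc-ext : ∀ {m n} {σ : Sub m n} {t} →
  Acc (flip _⟿sub_) σ → Acc (flip _⟿_) t → Acc (flip _⟿sub_) ⟨ σ , t ⟩
⟿-acc-ext (acc rσ) (acc rt) = acc λ where
  (init p) → ⟿-acc-ext (rσ p) (acc rt)
  (last p) → ⟿-acc-ext (acc rσ) (rt p)

VanishesFrom : ℕ → (ℕ → ℕ) → Set
VanishesFrom n f = ∀ {d} → n ≤ d → f d ≡ 0

CellsTerminateBelow : ℕ → Set
CellsTerminateBelow n = ∀ {m} {Δ : Ctx m} {A} → Δ ⊢ty A → dimTy A < n → SNTy Δ A

-- Each counted coherence makes the coefficient at its dimension positive, so vanishing from `k` on
-- forces its cell below `k`, where cells terminate.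
⟿-acc : ∀ {n k} {Γ : Ctx n} t {A} → CellsTerminateBelow k → Γ ⊢tm t ∶ A →
  VanishesFrom k (complexity t) → Acc (flip _⟿_) t
⟿sub-acc : ∀ {m n k} {Γ : Ctx n} {Δ : Ctx m} σ → CellsTerminateBelow k → Γ ⊢sub σ ∶ Δ →
  VanishesFrom k (complexitySub σ) → Acc (flip _⟿sub_) σ

⟿-acc (var x) cells ⊢t v = acc λ ()
⟿-acc {k = k} (Coh Δ A σ) cells ⊢t v = let ⊢A , ⊢σ = coh-inversion ⊢t in
  ⟿-acc-coh (cells ⊢A (≰⇒> A-low))
    (⟿sub-acc σ cells ⊢σ λ {d} k≤d → m+n≡0⇒n≡0 (monomial (weight Δ A) (dimTy A) d) (v k≤d))
  where
  A-low : ¬ k ≤ dimTy A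
  A-low k≤A = contradiction
    (≤-trans (coh-positive Δ A) (≤-reflexive (m+n≡0⇒m≡0 _ (v k≤A)))) λ ()

⟿sub-acc ⟨⟩        cells ⊢σ v = acc λ ()
⟿sub-acc ⟨ σ , t ⟩ cells (sub-, ⊢σ ⊢t) v = ⟿-acc-ext
  (⟿sub-acc σ cells ⊢σ λ k≤d → m+n≡0⇒m≡0 _ (v k≤d))
  (⟿-acc t cells ⊢t λ {d} k≤d → m+n≡0⇒n≡0 (complexitySub σ d) (v k≤d))

-- The drop occurs where `h` is positive, hence below `k`; above the drop `f` is bounded by `h` and
-- vanishes with it.
≺-bounded : ∀ {k f g h} → VanishesFrom k h → g ≼ h → f ≺ g → f ≺⟨ k ⟩ h × VanishesFrom k f
≺-bounded {k} {f} {g} {h} h↓ g≼h (d , f<g , f≤g) =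
  (d , d<k , f<h , λ e d<e _ → f≤h d<e) ,
  λ k≤e → n≤0⇒n≡0 (≤-trans (f≤h (<-≤-trans d<k k≤e)) (≤-reflexive (h↓ k≤e)))
  where
  f<h : f d < h d
  f<h = <-≤-trans f<g (g≼h d)
  f≤h : ∀ {e} → d < e → f e ≤ h e
  f≤h {e} d<e = ≤-trans (f≤g e d<e) (g≼h e)
  d<k : d < k
  d<k = ≰⇒> λ k≤d → n≮0 (<-≤-trans f<h (≤-reflexive (h↓ k≤d)))

-- Lexicographic induction on the ordinal, then on steps inside cells. `f` is an upper bound, so it
-- can stay fixed during the latter; after a strict drop, accessibility for `⟿` is obtained anew
-- from `⟿-acc`.
sn-bounded : ∀ {n k} {Γ : Ctx n} → CellsTerminateBelow k →
  ∀ {f t} → Acc _≺⟨ k ⟩_ f → Acc (flip _⟿_) t →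
  VanishesFrom k f → complexity t ≼ f → SN Γ t
sn-bounded cells {f} {t} (acc rf) (acc rt) f↓ t≼f = acc λ {t′} (wt , wt′ , p) →
  [ (λ t′≺t → let t′≺f , t′↓ = ≺-bounded {f = complexity t′} f↓ t≼f t′≺t in
      sn-bounded cells (rf t′≺f) (⟿-acc t′ cells (proj₂ wt′) t′↓) t′↓ λ _ → ≤-refl)
  , (λ (q , t′≼t) →
      sn-bounded cells (acc rf) (rt q) f↓ λ d → ≤-trans (t′≼t d) (t≼f d))
  ]′ (step-complexity wt wt′ p)

sn-vanishing : ∀ {n k} {Γ : Ctx n} {t A} → CellsTerminateBelow k → Γ ⊢tm t ∶ A →
  VanishesFrom k (complexity t) → SN Γ t
sn-vanishing {k = k} {t = t} cells ⊢t t↓ =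
  sn-bounded cells (≺⟨⟩-wellFounded k (complexity t)) (⟿-acc t cells ⊢t t↓) t↓ λ _ → ≤-refl

-- The endpoints of an arrow type of dimension below `suc k` have a type of dimension below `k`, so
-- the cells counted in them fall under the induction hypothesis.
sn-cells : ∀ k → CellsTerminateBelow k
sn-cells (suc k) ty-⋆ _ = acc λ { (_ , _ , ()) }
sn-cells (suc k) {A = s ─⟨ A ⟩→ t} (ty-→ ⊢A ⊢s ⊢t) A<k =
  sn-arrow (endpoint ⊢s) (sn-cells k ⊢A (s<s⁻¹ A<k)) (endpoint ⊢t)
  where
  endpoint : ∀ {u} → _ ⊢tm u ∶ A → SN _ u
  endpoint ⊢u =
    sn-vanishing (sn-cells k) ⊢u λ k≤d → complexity-bound ⊢u (<-≤-trans (s<s⁻¹ A<k) k≤d)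

sn : ∀ {n} {Γ : Ctx n} {t} → WellFormed Γ t → SN Γ t
sn (A , ⊢t) = sn-vanishing (sn-cells (suc (dimTy A))) ⊢t (complexity-bound ⊢t)

corollary4p3p12 : StronglyTerminating sua′
corollary4p3p12 Γ (s , s⇝) = go 0 (sn (proj₁ (s⇝ 0)))
  where
  go : ∀ i → ¬ SN Γ (s i)
  go i (acc r) = go (suc i) (r (s⇝ i))
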